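{- There exists a constant $\gamma>0.04$ such that the following holds: for every non-constant function $f:\{0,1\}^{m}\to\{0,1\}$ and for every $n\in\mathbb{N}$ there exists a function $g:\{0,1\}^{n}\to\{0,1\}$ such that \[ \mathsf{CC}(\mathit{KW}_{f}\circledast\mathit{KW}_{g})\ge\log\mathsf{L}(\mathit{KW}_{f})-(1-\gamma)\cdot m+n-O\left(\log(m\cdot n)\right), \] where the $O(\cdot)$ hides a universal constant.
   Context: All logarithms are base 2. For $g:\{0,1\}^n\to\{0,1\}$ and a matrix $X\in\{0,1\}^{m\times n}$ with rows $X_1,\dots,X_m$, $g(X)\in\{0,1\}^m$ is the column vector $(g(X_1),\dots,g(X_m))$, and the composition $f\diamond g:\{0,1\}^{m\times n}\to\{0,1\}$ is $(f\diamond g)(X)=f(g(X))$. For a non-constant $f$, the Karchmer–Wigderson relation $\mathit{KW}_f$ is the communication problem in which Alice gets $x\in f^{ -1}(1)$, Bob gets $y\in f^{ -1}(0)$, and they must output a coordinate $i$ with $x_i\neq y_i$. The strong composition $\mathit{KW}_f\circledast\mathit{KW}_g$ is the communication problem in which Alice gets $X\in(f\diamond g)^{ -1}(1)$, Bob gets $Y\in(f\diamond g)^{ -1}(0)$, and, writing $a=g(X)$, $b=g(Y)$, they must output an entry $(i,j)\in[m]\times[n]$ such that both $a_i\neq b_i$ and $X_{i,j}\neq Y_{i,j}$. $\mathsf{CC}(R)$ denotes the deterministic communication complexity of a relation $R$ (the minimal depth of a deterministic protocol tree solving $R$), and $\mathsf{L}(R)$ denotes the protocol size of $R$, i.e.,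 the minimal number of leaves of a deterministic protocol solving $R$ (for $R=\mathit{KW}_f$ this equals the minimal number of leaves of a de Morgan formula computing $f$). -}

module Defs where

open import Data.Nat using (ℕ; zero; suc; _+_; _*_; _≤_; _⊔_)
open import Data.Bool using (Bool; true; false)
open import Data.Fin using (Fin)
open import Data.Product using (Σ; _×_; _,_; ∃)
open import Relation.Binary.PropositionalEquality using (_≡_; _≢_)

BVec : ℕ → Set
BVec n = Fin n → Bool

BMat : ℕ → ℕ → Set
BMat m n = Fin m → Fin n → Bool

applyRows : ∀ {m n} → (BVec n → Bool) → BMat m n → BVec m
applyRows g X i = g (X i)

_◇_ : ∀ {m n} → (BVec m → Bool) → (BVec n → Bool) → BMat m n → Bool
(f ◇ g) X = f (applyRows g X)

NonConstant : ∀ {m} → (BVec m → Bool) → Set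
NonConstant f = (∃ λ x → f x ≡ true) × (∃ λ y → f y ≡ false)

record CommProblem (A B O : Set) : Set₁ where
  field
    AliceDom : A → Set
    BobDom   : B → Set
    Rel      : A → B → O → Set
open CommProblem public

data Protocol (A B O : Set) : Set where
  leaf  : O → Protocol A B O
  alice : (A → Bool) → Protocol A B O → Protocol A B O → Protocol A B O
  bob   : (B → Bool) → Protocol A B O → Protocol A B O → Protocol A B O

module _ {A B O : Set} where
  run : Protocol A B O → A → B → O
  run (leaf o) x y = o
  run (alice h l r) x y with h x
  ... | false = run l x y
  ... | true  = run r x y
  run (bob h l r) x y with h y
  ... | false = run l x y
  ... | true  = run r x y

  depth : Protocol A B O → ℕ
  depth (leaf _) = 0
  depth (alice _ l r) = suc (depth l ⊔ depth r)
  depth (bob _ l r) = suc (depth l ⊔ depth r)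

  leaves : Protocol A B O → ℕ
  leaves (leaf _) = 1
  leaves (alice _ l r) = leaves l + leaves r
  leaves (bob _ l r) = leaves l + leaves r

  Solves : Protocol A B O → CommProblem A B O → Set
  Solves P R = ∀ x y → AliceDom R x → BobDom R y → Rel R x y (run P x y)

  IsCC : CommProblem A B O → ℕ → Set
  IsCC R d = (Σ (Protocol A B O) λ P → Solves P R × depth P ≡ d)
           × (∀ P → Solves P R → d ≤ depth P)

  IsL : CommProblem A B O → ℕ → Set
  IsL R ℓ = (Σ (Protocol A B O) λ P → Solves P R × leaves P ≡ ℓ)
          × (∀ P → Solves P R → ℓ ≤ leaves P)

KW : ∀ {m} → (BVec m → Bool) → CommProblem (BVec m) (BVec m) (Fin m)
KW f = record
  { AliceDom = λ x → f x ≡ true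
  ; BobDom   = λ y → f y ≡ false
  ; Rel      = λ x y i → x i ≢ y i }

KW⊛ : ∀ {m n} → (BVec m → Bool) → (BVec n → Bool)
    → CommProblem (BMat m n) (BMat m n) (Fin m × Fin n)
KW⊛ f g = record
  { AliceDom = λ X → (f ◇ g) X ≡ true
  ; BobDom   = λ Y → (f ◇ g) Y ≡ false
  ; Rel      = λ { X Y (i , j) → (g (X i) ≢ g (Y i)) × (X i j ≢ Y i j) } }

{-# OPTIONS --safe #-}
module Submission where

open import Defs
open import Data.Nat using (ℕ; zero; suc; _+_; _*_; _^_; _∸_; _≤_; _<_; _⊔_; _≤ᵇ_; z≤n; s≤s; NonZero; >-nonZero)
open import Data.Nat.Properties
open import Data.Nat.Tactic.RingSolver using (solve-∀)
open import Data.Bool using (Bool; T; true; false; not; _∧_; _∨_; _xor_; if_then_else_)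
open import Data.Fin using (Fin; zero; suc)
open import Data.Vec using (Vec; []; _∷_; lookup; tabulate; zipWith; replicate)
open import Data.Vec.Properties using (lookup∘tabulate; tabulate∘lookup; lookup-zipWith)
open import Data.List using (List; []; _∷_; _++_; map; length; allFin; cartesianProductWith)
open import Data.List.Properties using (length-++; length-tabulate)
open import Data.List.Membership.Propositional using (_∈_)
open import Data.List.Membership.Propositional.Properties using (∈-cartesianProductWith⁺; ∈-allFin; ∈-++⁺ˡ; ∈-++⁺ʳ)
open import Data.List.Relation.Unary.Any using (here; there)
open import Data.Product using (Σ; _×_; _,_; ∃; ∃₂; proj₁; proj₂)
open import Data.Sum using (_⊎_; inj₁; inj₂)
open import Data.Empty using (⊥; ⊥-elim)
open import Data.Unit using (tt)
open import Function using (_∘_)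
open import Relation.Nullary using (yes; no)
open import Relation.Binary.PropositionalEquality using (module ≡-Reasoning; _≡_; _≢_; refl; sym; trans; cong; cong₂; subst; subst₂)

-- The inner function is g(x₀, u) = x₀ xor h(u) for a truth table h on N = 2 ^ (n - 1) points, so the
-- matrices X with g(X) = a correspond to tuples in [N] ^ m. A set of tuples wins on D ⊆ [m] if it admits
-- a subtree with at least 2N/3 children at the coordinates in D and one child at the others.
--
-- Follow a protocol of depth t + e for t steps; each player's input a always moves to the side that
-- keeps at least half of its tuples. Suppose first that two inputs a, b remain whose tuple sets both
-- win on D = {i : aᵢ ≠ bᵢ}. The remaining protocol of depth e then gives a formula of depth e that
-- separates them and reads only rows in D. For a fixed (a, b, formula) this happens for few h only:
-- among many such h, one could choose h for Alice and h' for Bob with opposite values at a common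
-- point of every row in D, walking to one matrix that the formula both accepts and rejects. By a union
-- bound some h avoids this for all formulas of depth e = n - O(log(mn)).
--
-- For this h no two remaining inputs win on their difference set. A set of tuples of density 2 ^ -s
-- wins on I for a 2 ^ -s fraction of the random sets I (each coordinate outside with probability 2/3).
-- So few sets I cover Alice's inputs and few sets J cover Bob's, and inputs covered by I and J differ
-- outside I ∩ J, which 3 * 2 ^ (m - |I ∩ J|) leaves resolve. Since 𝔼 2 ^ (m - |I ∩ J|) = (17/9) ^ m, this
-- solves KW_f with (17/9) ^ m * 2 ^ (2t) leaves up to polynomial factors. Multiplying with the trivial
-- bound 3 * 2 ^ m gives t ≥ log L - (1 - γ) m - O(log m) for γ = log(18/17) / 2 > 7/170.

private
  variable
    A B : Set

-- Finite sums and enumerations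

∑ : List A → (A → ℕ) → ℕ
∑ [] f = 0
∑ (x ∷ l) f = f x + ∑ l f

⟦_⟧ : Bool → ℕ
⟦ true ⟧ = 1
⟦ false ⟧ = 0

∑-cong : (l : List A) {f g : A → ℕ} → (∀ x → f x ≡ g x) → ∑ l f ≡ ∑ l g
∑-cong [] e = refl
∑-cong (x ∷ l) e = cong₂ _+_ (e x) (∑-cong l e)

∑-mono : (l : List A) {f g : A → ℕ} → (∀ x → f x ≤ g x) → ∑ l f ≤ ∑ l g
∑-mono [] e = z≤n
∑-mono (x ∷ l) e = +-mono-≤ (e x) (∑-mono l e)

∑-+ : (l : List A) (f g : A → ℕ) → ∑ l (λ x → f x + g x) ≡ ∑ l f + ∑ l g
∑-+ [] f g = refl
∑-+ (x ∷ l) f g rewrite ∑-+ l f g = interchange (f x) (g x) (∑ l f) (∑ l g)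
  where
  interchange : ∀ a b c d → (a + b) + (c + d) ≡ (a + c) + (b + d)
  interchange = solve-∀

∑-*ˡ : (l : List A) (c : ℕ) (f : A → ℕ) → ∑ l (λ x → c * f x) ≡ c * ∑ l f
∑-*ˡ [] c f = sym (*-zeroʳ c)
∑-*ˡ (x ∷ l) c f rewrite ∑-*ˡ l c f = sym (*-distribˡ-+ c (f x) (∑ l f))

∑-*ʳ : (l : List A) (c : ℕ) (f : A → ℕ) → ∑ l (λ x → f x * c) ≡ ∑ l f * c
∑-*ʳ [] c f = refl
∑-*ʳ (x ∷ l) c f rewrite ∑-*ʳ l c f = sym (*-distribʳ-+ c (f x) (∑ l f))

∑-const : (l : List A) (c : ℕ) → ∑ l (λ _ → c) ≡ length l * c
∑-const [] c = refl
∑-const (x ∷ l) c = cong (c +_) (∑-const l c)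

∑-1 : (l : List A) → ∑ l (λ _ → 1) ≡ length l
∑-1 l = trans (∑-const l 1) (*-identityʳ (length l))

∑-swap : (k : List A) (l : List B) (f : A → B → ℕ) →
  ∑ k (λ x → ∑ l (f x)) ≡ ∑ l (λ y → ∑ k (λ x → f x y))
∑-swap [] l f = sym (trans (∑-const l 0) (*-zeroʳ (length l)))
∑-swap (x ∷ k) l f rewrite ∑-swap k l f = sym (∑-+ l (f x) (λ y → ∑ k (λ x → f x y)))

∑-++ : (k l : List A) (f : A → ℕ) → ∑ (k ++ l) f ≡ ∑ k f + ∑ l f
∑-++ [] l f = refl
∑-++ (x ∷ k) l f rewrite ∑-++ k l f = sym (+-assoc (f x) (∑ k f) (∑ l f))

∑-map : (g : A → B) (l : List A) (f : B → ℕ) → ∑ (map g l) f ≡ ∑ l (f ∘ g)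
∑-map g [] f = refl
∑-map g (x ∷ l) f = cong (f (g x) +_) (∑-map g l f)

∑-product : {C : Set} (g : A → B → C) (k : List A) (l : List B) (f : C → ℕ) →
  ∑ (cartesianProductWith g k l) f ≡ ∑ k (λ x → ∑ l (λ y → f (g x y)))
∑-product g [] l f = refl
∑-product g (x ∷ k) l f =
  trans (∑-++ (map (g x) l) _ f) (cong₂ _+_ (∑-map (g x) l f) (∑-product g k l f))

length-product : {C : Set} (g : A → B → C) (k : List A) (l : List B) →
  length (cartesianProductWith g k l) ≡ length k * length l
length-product g k l =
  trans (sym (∑-1 (cartesianProductWith g k l)))
  (trans (∑-product g k l (λ _ → 1))
  (trans (∑-const k (∑ l (λ _ → 1))) (cong (length k *_) (∑-1 l))))

∑-exists-< : (l : List A) (f g : A → ℕ) → ∑ l f < ∑ l g → ∃ λ x → f x < g x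
∑-exists-< (x ∷ l) f g lt with f x <? g x
... | yes p = x , p
... | no ¬p with ∑ l f <? ∑ l g
...   | yes q = ∑-exists-< l f g q
...   | no ¬q = ⊥-elim (<⇒≱ lt (+-mono-≤ (≮⇒≥ ¬p) (≮⇒≥ ¬q)))

∑-exists-≤ : (l : List A) (f g : A → ℕ) → 1 ≤ length l → ∑ l f ≤ ∑ l g → ∃ λ x → f x ≤ g x
∑-exists-≤ l f g ne le = let x , lt = ∑-exists-< l f (suc ∘ g) strict in x , ≤-pred lt
  where
  strict : ∑ l f < ∑ l (suc ∘ g)
  strict = subst (∑ l f <_) (sym (trans (∑-+ l (λ _ → 1) g) (cong (_+ ∑ l g) (∑-1 l))))
    (+-mono-≤ ne le)

∈⇒≤∑ : {l : List A} {x : A} (f : A → ℕ) → x ∈ l → f x ≤ ∑ l f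
∈⇒≤∑ f (here refl) = m≤m+n _ _
∈⇒≤∑ f (there p) = ≤-trans (∈⇒≤∑ f p) (m≤n+m _ _)

-- Boolean tests and finite search.

true≢false : {b : Bool} → b ≡ true → b ≡ false → ⊥
true≢false refl ()

⟦⟧-true : {b : Bool} → 1 ≤ ⟦ b ⟧ → b ≡ true
⟦⟧-true {true} _ = refl

⟦⟧-≤1 : (b : Bool) → ⟦ b ⟧ ≤ 1
⟦⟧-≤1 true = ≤-refl
⟦⟧-≤1 false = z≤n

⟦⟧-mono : {a b : Bool} → (a ≡ true → b ≡ true) → ⟦ a ⟧ ≤ ⟦ b ⟧
⟦⟧-mono {true} f rewrite f refl = ≤-refl
⟦⟧-mono {false} f = z≤n

∧-true⁻ : {a b : Bool} → a ∧ b ≡ true → a ≡ true × b ≡ true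
∧-true⁻ {true} {true} _ = refl , refl

∧-true⁺ : {a b : Bool} → a ≡ true → b ≡ true → a ∧ b ≡ true
∧-true⁺ refl refl = refl

not-true⁻ : {b : Bool} → not b ≡ true → b ≡ false
not-true⁻ {false} _ = refl

≤ᵇ-true⁻ : ∀ {m n} → (m ≤ᵇ n) ≡ true → m ≤ n
≤ᵇ-true⁻ {m} {n} e = ≤ᵇ⇒≤ m n (subst T (sym e) tt)

≤ᵇ-true⁺ : ∀ {m n} → m ≤ n → (m ≤ᵇ n) ≡ true
≤ᵇ-true⁺ {m} {n} p with m ≤ᵇ n | ≤⇒≤ᵇ p
... | true | _ = refl

≤ᵇ-false⁻ : ∀ {m n} → (m ≤ᵇ n) ≡ false → n < m
≤ᵇ-false⁻ {m} {n} e = ≰⇒> λ p → true≢false (≤ᵇ-true⁺ p) e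

search : (p : A → Bool) (l : List A) →
  (∃ λ x → p x ≡ true) ⊎ (∀ {x} → x ∈ l → p x ≡ false)
search p [] = inj₂ λ ()
search p (x ∷ l) with p x in e
... | true = inj₁ (x , e)
... | false with search p l
...   | inj₁ r = inj₁ r
...   | inj₂ r = inj₂ λ { (here refl) → e ; (there q) → r q }

vecs : List A → ∀ m → List (Vec A m)
vecs l zero = [] ∷ []
vecs l (suc m) = cartesianProductWith _∷_ l (vecs l m)

∑-vecs : (l : List A) → ∀ m (f : Vec A (suc m) → ℕ) →
  ∑ (vecs l (suc m)) f ≡ ∑ l (λ x → ∑ (vecs l m) (λ v → f (x ∷ v)))
∑-vecs l m f = ∑-product _∷_ l (vecs l m) f

length-vecs : (l : List A) → ∀ m → length (vecs l m) ≡ length l ^ m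
length-vecs l zero = refl
length-vecs l (suc m) =
  trans (length-product _∷_ l (vecs l m)) (cong (length l *_) (length-vecs l m))

∈-vecs : (l : List A) → (∀ x → x ∈ l) → ∀ {m} (v : Vec A m) → v ∈ vecs l m
∈-vecs l e [] = here refl
∈-vecs l e (x ∷ v) = ∈-cartesianProductWith⁺ _∷_ (e x) (∈-vecs l e v)

bools : List Bool
bools = true ∷ false ∷ []

∈-bools : ∀ b → b ∈ bools
∈-bools true = here refl
∈-bools false = there (here refl)

-- Winning index sets

tff : List Bool
tff = true ∷ false ∷ false ∷ []

module _ {U : Set} (K : List U) where

  -- Coordinates in D must be won by at least two thirds of the values, the others by one value.
  win : ∀ {m} → Vec Bool m → (Vec U m → Bool) → Bool
  win [] χ = χ []
  win (true ∷ D) χ = 2 * length K ≤ᵇ 3 * ∑ K (λ u → ⟦ win D (λ v → χ (u ∷ v)) ⟧)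
  win (false ∷ D) χ = 1 ≤ᵇ ∑ K (λ u → ⟦ win D (λ v → χ (u ∷ v)) ⟧)

  count : ∀ {m} → (Vec U m → Bool) → ℕ
  count {m} χ = ∑ (vecs K m) (λ v → ⟦ χ v ⟧)

  private
    M = length K

    -- If 3k ≥ 2M, all three entries of `tff` count, and 3M ≥ 3k. If 0 < 3k < 2M, only the two
    -- `false` entries count, and 2M > 3k. So the threshold two thirds fits the weights 1 and 2.
    thirds : (k : ℕ) → k ≤ M → 3 * k ≤ M * (⟦ 2 * M ≤ᵇ 3 * k ⟧ + (⟦ 1 ≤ᵇ k ⟧ + (⟦ 1 ≤ᵇ k ⟧ + 0)))
    thirds zero _ = z≤n
    thirds (suc k) k≤M with 2 * M ≤ᵇ 3 * suc k in e
    ... | true = ≤-trans (*-monoʳ-≤ 3 k≤M) (≤-reflexive (*-comm 3 M))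
    ... | false = ≤-trans (<⇒≤ (≤ᵇ-false⁻ e)) (≤-reflexive (*-comm 2 M))

  -- The list vecs tff m gives a set I the weight 2 ^ (number of coordinates outside I).
  win-count : ∀ {m} (χ : Vec U m → Bool) →
    3 ^ m * count χ ≤ M ^ m * ∑ (vecs tff m) (λ I → ⟦ win I χ ⟧)
  win-count {zero} χ = ≤-refl
  win-count {suc m} χ = begin
    3 * 3 ^ m * count χ
      ≡⟨ cong (3 * 3 ^ m *_) (∑-vecs K m _) ⟩
    3 * 3 ^ m * ∑ K (λ u → count (χ∷ u))
      ≡⟨ *-assoc 3 (3 ^ m) _ ⟩
    3 * (3 ^ m * ∑ K (λ u → count (χ∷ u)))
      ≡⟨ cong (3 *_) (sym (∑-*ˡ K (3 ^ m) _)) ⟩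
    3 * ∑ K (λ u → 3 ^ m * count (χ∷ u))
      ≤⟨ *-monoʳ-≤ 3 (∑-mono K (λ u → win-count (χ∷ u))) ⟩
    3 * ∑ K (λ u → M ^ m * ∑ W (λ I → ⟦ win I (χ∷ u) ⟧))
      ≡⟨ cong (3 *_) (∑-*ˡ K (M ^ m) _) ⟩
    3 * (M ^ m * ∑ K (λ u → ∑ W (λ I → ⟦ win I (χ∷ u) ⟧)))
      ≡⟨ cong (λ z → 3 * (M ^ m * z)) (∑-swap K W _) ⟩
    3 * (M ^ m * ∑ W won)
      ≡⟨ trans (x∙yz≡y∙xz 3 (M ^ m) _) (cong (M ^ m *_) (sym (∑-*ˡ W 3 won))) ⟩
    M ^ m * ∑ W (λ I → 3 * won I)
      ≤⟨ *-monoʳ-≤ (M ^ m) (∑-mono W λ I → thirds (won I) (won≤ I)) ⟩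
    M ^ m * ∑ W (λ I → M * (t I + (f I + (f I + 0))))
      ≡⟨ cong (M ^ m *_) (trans (∑-*ˡ W M _) (cong (M *_) sum-tff)) ⟩
    M ^ m * (M * ∑ (vecs tff (suc m)) (λ I → ⟦ win I χ ⟧))
      ≡⟨ trans (x∙yz≡y∙xz (M ^ m) M _) (sym (*-assoc M (M ^ m) _)) ⟩
    M * M ^ m * ∑ (vecs tff (suc m)) (λ I → ⟦ win I χ ⟧) ∎
    where
    open ≤-Reasoning
    W = vecs tff m
    χ∷ : U → Vec U m → Bool
    χ∷ u v = χ (u ∷ v)
    won t f : Vec Bool m → ℕ
    won I = ∑ K (λ u → ⟦ win I (χ∷ u) ⟧)
    t I = ⟦ win (true ∷ I) χ ⟧
    f I = ⟦ win (false ∷ I) χ ⟧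
    won≤ : ∀ I → won I ≤ M
    won≤ I = ≤-trans (∑-mono K (λ u → ⟦⟧-≤1 (win I (χ∷ u)))) (≤-reflexive (∑-1 K))
    x∙yz≡y∙xz : ∀ x y z → x * (y * z) ≡ y * (x * z)
    x∙yz≡y∙xz = solve-∀
    sum-tff : ∑ W (λ I → t I + (f I + (f I + 0))) ≡ ∑ (vecs tff (suc m)) (λ I → ⟦ win I χ ⟧)
    sum-tff = trans (∑-swap W tff (λ I b → ⟦ win (b ∷ I) χ ⟧))
                    (sym (∑-vecs tff m (λ I → ⟦ win I χ ⟧)))

  win-all : 1 ≤ M → ∀ {m} (D : Vec Bool m) (χ : Vec U m → Bool) → (∀ v → χ v ≡ true) → win D χ ≡ true
  win-all ne [] χ h = h []
  win-all ne (b ∷ D) χ h with ∑-cong K (λ u → cong ⟦_⟧ (win-all ne D (λ v → χ (u ∷ v)) (λ v → h (u ∷ v))))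
  win-all ne (true ∷ D) χ h | e rewrite e | ∑-1 K = ≤ᵇ-true⁺ {2 * M} (*-monoˡ-≤ M {2} {3} (s≤s (s≤s z≤n)))
  win-all ne (false ∷ D) χ h | e rewrite e | ∑-1 K = ≤ᵇ-true⁺ ne

  -- Two thirds of a nonempty list is at least one value, so removing a coordinate from the set only
  -- weakens the demand.
  win-⊆ : 1 ≤ M → ∀ {m} (D I : Vec Bool m) (χ : Vec U m → Bool) →
    (∀ i → lookup D i ≡ true → lookup I i ≡ true) → win I χ ≡ true → win D χ ≡ true
  win-⊆ ne [] [] χ s w = w
  win-⊆ ne (d ∷ D) (i ∷ I) χ s w
    with ∑-mono K (λ u → ⟦⟧-mono (win-⊆ ne D I (λ v → χ (u ∷ v)) (λ j → s (suc j))))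
  win-⊆ ne (true ∷ D) (true ∷ I) χ s w | le = ≤ᵇ-true⁺ (≤-trans (≤ᵇ-true⁻ {2 * M} w) (*-monoʳ-≤ 3 le))
  win-⊆ ne (true ∷ D) (false ∷ I) χ s w | le with s zero refl
  ... | ()
  win-⊆ ne (false ∷ D) (true ∷ I) χ s w | le =
    ≤ᵇ-true⁺ (≤-trans (positive _ (≤-trans (≤-trans ne (m≤m+n M _)) (≤ᵇ-true⁻ {2 * M} w))) le)
    where
    positive : ∀ k → 1 ≤ 3 * k → 1 ≤ k
    positive (suc k) _ = s≤s z≤n
  win-⊆ ne (false ∷ D) (false ∷ I) χ s w | le = ≤ᵇ-true⁺ (≤-trans (≤ᵇ-true⁻ w) le)

-- Greedy covers

missed : {A B : Set} → (A → B → Bool) → List A → B → Bool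
missed covers [] y = true
missed covers (x ∷ F) y = not (covers x y) ∧ missed covers F y

module _ {X Y : Set} (W : List X) (W≢[] : 1 ≤ length W) (L : List Y) (covers : X → Y → Bool)
         (T : ℕ) (c : X → ℕ) (c≥1 : ∀ x → 1 ≤ c x) where

  private
    S = length W

    size : (Y → Bool) → ℕ
    size ρ = ∑ L (λ y → ⟦ ρ y ⟧)

    hits : X → (Y → Bool) → ℕ
    hits x ρ = size (λ y → ρ y ∧ covers x y)

    rest : List X → (Y → Bool) → Y → Bool
    rest [] ρ = ρ
    rest (x ∷ F) ρ = rest F (λ y → ρ y ∧ not (covers x y))

    -- Every remaining element is covered by at least a 1/T fraction of the list `W`, a property
    -- that survives when elements are removed.
    Dense : (Y → Bool) → Set
    Dense ρ = ∀ y → ρ y ≡ true → S ≤ T * ∑ W (λ x → ⟦ covers x y ⟧)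

    dense-rest : ∀ F ρ → Dense ρ → Dense (rest F ρ)
    dense-rest [] ρ d = d
    dense-rest (x ∷ F) ρ d = dense-rest F _ (λ y e → d y (proj₁ (∧-true⁻ e)))

    rest-++ : ∀ F G ρ → rest (F ++ G) ρ ≡ rest G (rest F ρ)
    rest-++ [] G ρ = refl
    rest-++ (x ∷ F) G ρ = rest-++ F G _

    rest-missed : ∀ F ρ y → ρ y ≡ true → missed covers F y ≡ true → rest F ρ y ≡ true
    rest-missed [] ρ y p q = p
    rest-missed (x ∷ F) ρ y p q =
      let q₁ , q₂ = ∧-true⁻ q in rest-missed F _ y (∧-true⁺ p q₁) q₂

    size-split : ∀ x ρ → hits x ρ + size (λ y → ρ y ∧ not (covers x y)) ≡ size ρ
    size-split x ρ = trans (sym (∑-+ L _ _)) (∑-cong L λ y → split (ρ y) (covers x y))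
      where
      split : ∀ a b → ⟦ a ∧ b ⟧ + ⟦ a ∧ not b ⟧ ≡ ⟦ a ⟧
      split true true = refl
      split true false = refl
      split false b = refl

    -- Some x costs at most the average cost per newly covered element.
    pick : ∀ ρ → Dense ρ → ∃ λ x → c x * (S * size ρ) ≤ T * ∑ W c * hits x ρ
    pick ρ d = ∑-exists-≤ W _ _ W≢[] (begin
      ∑ W (λ x → c x * (S * size ρ))
        ≡⟨ ∑-*ʳ W (S * size ρ) c ⟩
      ∑ W c * (S * size ρ)
        ≡⟨ cong (∑ W c *_) (sym (∑-*ˡ L S _)) ⟩
      ∑ W c * ∑ L (λ y → S * ⟦ ρ y ⟧)
        ≤⟨ *-monoʳ-≤ (∑ W c) (∑-mono L pointwise) ⟩
      ∑ W c * ∑ L (λ y → T * ∑ W (λ x → ⟦ ρ y ∧ covers x y ⟧))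
        ≡⟨ cong (∑ W c *_) (trans (∑-*ˡ L T _) (cong (T *_) (∑-swap L W _))) ⟩
      ∑ W c * (T * ∑ W (λ x → hits x ρ))
        ≡⟨ rearrange (∑ W c) T _ ⟩
      T * ∑ W c * ∑ W (λ x → hits x ρ)
        ≡⟨ sym (∑-*ˡ W (T * ∑ W c) _) ⟩
      ∑ W (λ x → T * ∑ W c * hits x ρ) ∎)
      where
      open ≤-Reasoning
      rearrange : ∀ a b c → a * (b * c) ≡ b * a * c
      rearrange = solve-∀
      pointwise : ∀ y → S * ⟦ ρ y ⟧ ≤ T * ∑ W (λ x → ⟦ ρ y ∧ covers x y ⟧)
      pointwise y with ρ y in e
      ... | true = ≤-trans (≤-reflexive (*-identityʳ S)) (d y e)
      ... | false = ≤-trans (≤-reflexive (*-zeroʳ S)) z≤n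

    -- While at least `r` elements remain, the cost of each pick is charged to the elements it newly
    -- covers, at a rate of at most T * ∑ W c / (S * r). Each element is charged at most once. The
    -- argument `k` is fuel.
    shrink : ∀ r → 1 ≤ r → ∀ k ρ → size ρ ≤ k → Dense ρ →
      ∃ λ F → size (rest F ρ) < r × ∑ F c * (S * r) ≤ T * ∑ W c * size ρ
    shrink r r≥1 k ρ le d with size ρ <? r
    ... | yes lt = [] , lt , z≤n
    ... | no ¬lt with pick ρ d
    ...   | x , px with hits x ρ in eh
    -- A pick that covers nothing new would bound a positive product by zero.
    ...     | zero = ⊥-elim (<⇒≱ (*-mono-≤ (c≥1 x) (*-mono-≤ W≢[] (≤-trans r≥1 (≮⇒≥ ¬lt))))
                              (≤-trans px (≤-reflexive (*-zeroʳ (T * ∑ W c)))))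
    ...     | suc h with k | subst (_≤ k) (sym (size-split x ρ)) le
    ...       | zero | le' = ⊥-elim (<⇒≱ (subst (λ z → 1 ≤ z + size (λ y → ρ y ∧ not (covers x y))) (sym eh) (s≤s z≤n)) le')
    ...       | suc k' | le'
      with shrink r r≥1 k' (λ y → ρ y ∧ not (covers x y))
             (≤-trans (m≤n+m _ h) (≤-pred (subst (λ z → z + size (λ y → ρ y ∧ not (covers x y)) ≤ suc k') eh le')))
             (dense-rest (x ∷ []) ρ d)
    ...       | F , lt , cost = x ∷ F , lt , (begin
      (c x + ∑ F c) * (S * r)
        ≡⟨ *-distribʳ-+ (S * r) (c x) (∑ F c) ⟩
      c x * (S * r) + ∑ F c * (S * r)
        ≤⟨ +-mono-≤ (≤-trans (*-monoʳ-≤ (c x) (*-monoʳ-≤ S (≮⇒≥ ¬lt))) px) cost ⟩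
      T * ∑ W c * suc h + T * ∑ W c * size (λ y → ρ y ∧ not (covers x y))
        ≡⟨ sym (*-distribˡ-+ (T * ∑ W c) (suc h) _) ⟩
      T * ∑ W c * (suc h + size (λ y → ρ y ∧ not (covers x y)))
        ≡⟨ cong (λ z → T * ∑ W c * (z + size (λ y → ρ y ∧ not (covers x y)))) (sym eh) ⟩
      T * ∑ W c * (hits x ρ + size (λ y → ρ y ∧ not (covers x y)))
        ≡⟨ cong (T * ∑ W c *_) (size-split x ρ) ⟩
      T * ∑ W c * size ρ ∎)
      where open ≤-Reasoning

    -- Each halving of the uncovered part costs at most 2 T times the average cost.
    halvings : ∀ k ρ → size ρ < 2 ^ k → Dense ρ →
      ∃ λ F → size (rest F ρ) < 1 × ∑ F c * S ≤ 2 * k * (T * ∑ W c)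
    halvings zero ρ lt d = [] , lt , z≤n
    halvings (suc k) ρ lt d
      with shrink (2 ^ k) (m^n>0 2 k) (size ρ) ρ ≤-refl d
    ... | F , ltF , costF with halvings k (rest F ρ) ltF (dense-rest F ρ d)
    ...   | G , ltG , costG =
      F ++ G , subst (λ z → size z < 1) (sym (rest-++ F G ρ)) ltG , (begin
        ∑ (F ++ G) c * S
          ≡⟨ trans (cong (_* S) (∑-++ F G c)) (*-distribʳ-+ S (∑ F c) (∑ G c)) ⟩
        ∑ F c * S + ∑ G c * S
          ≤⟨ +-mono-≤ (*-cancelʳ-≤ (∑ F c * S) (2 * (T * ∑ W c)) (2 ^ k) {{m^n≢0 2 k}} halved) costG ⟩
        2 * (T * ∑ W c) + 2 * k * (T * ∑ W c)
          ≡⟨ collect k (T * ∑ W c) ⟩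
        2 * suc k * (T * ∑ W c) ∎)
      where
      open ≤-Reasoning
      collect : ∀ k a → 2 * a + 2 * k * a ≡ 2 * (1 + k) * a
      collect = solve-∀
      rearrange : ∀ a b → a * (2 * b) ≡ 2 * a * b
      rearrange = solve-∀
      halved : ∑ F c * S * 2 ^ k ≤ 2 * (T * ∑ W c) * 2 ^ k
      halved = begin
        ∑ F c * S * 2 ^ k       ≡⟨ *-assoc (∑ F c) S (2 ^ k) ⟩
        ∑ F c * (S * 2 ^ k)     ≤⟨ costF ⟩
        T * ∑ W c * size ρ      ≤⟨ *-monoʳ-≤ (T * ∑ W c) (<⇒≤ lt) ⟩
        T * ∑ W c * (2 * 2 ^ k) ≡⟨ rearrange (T * ∑ W c) (2 ^ k) ⟩
        2 * (T * ∑ W c) * 2 ^ k ∎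

  -- Greedy weighted set cover: `k` halvings bring fewer than 2 ^ k elements down to none, so the
  -- total cost is at most 2 k T times the average cost over `W`.
  cover : ∀ k (ρ : Y → Bool) → length L < 2 ^ k →
    (∀ y → ρ y ≡ true → S ≤ T * ∑ W (λ x → ⟦ covers x y ⟧)) →
    ∃ λ F → (∀ {y} → y ∈ L → ρ y ≡ true → missed covers F y ≡ false) ×
            ∑ F c * S ≤ 2 * k * (T * ∑ W c)
  cover k ρ lt d with halvings k ρ (≤-<-trans size≤ lt) d
    where
    size≤ : size ρ ≤ length L
    size≤ = ≤-trans (∑-mono L (λ y → ⟦⟧-≤1 (ρ y))) (≤-reflexive (∑-1 L))
  ... | F , none , cost = F , covered , cost
    where
    covered : ∀ {y} → y ∈ L → ρ y ≡ true → missed covers F y ≡ false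
    covered {y} y∈L p with missed covers F y in e
    ... | false = refl
    ... | true = ⊥-elim (<⇒≱ none (subst (λ b → ⟦ b ⟧ ≤ size (rest F ρ))
                   (rest-missed F ρ y p e) (∈⇒≤∑ (λ y → ⟦ rest F ρ y ⟧) y∈L)))

-- Protocols for Karchmer–Wigderson relations

KWProtocol : ℕ → Set
KWProtocol m = Protocol (BVec m) (BVec m) (Fin m)

-- 2 ^ (number of coordinates outside S)
outside : ∀ {k} → Vec Bool k → ℕ
outside [] = 1
outside (true ∷ S) = outside S
outside (false ∷ S) = 2 * outside S

outside≥1 : ∀ {k} (S : Vec Bool k) → 1 ≤ outside S
outside≥1 [] = ≤-refl
outside≥1 (true ∷ S) = outside≥1 S
outside≥1 (false ∷ S) = ≤-trans (outside≥1 S) (m≤m+n _ _)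

outside-≤ : ∀ {k} (S : Vec Bool k) → outside S ≤ 2 ^ k
outside-≤ [] = ≤-refl
outside-≤ (true ∷ S) = ≤-trans (outside-≤ S) (m≤m+n _ _)
outside-≤ (false ∷ S) = *-monoʳ-≤ 2 (outside-≤ S)

_∩_ : ∀ {k} → Vec Bool k → Vec Bool k → Vec Bool k
_∩_ = zipWith _∧_

-- The sum factors over the coordinates. Of the nine pairs from `tff`, one is in both sets and
-- weighs 1, the other eight weigh 2, and 1 + 8 * 2 = 17.
∑∑-outside : ∀ k → ∑ (vecs tff k) (λ I → ∑ (vecs tff k) (λ J → outside (I ∩ J))) ≡ 17 ^ k
∑∑-outside zero = refl
∑∑-outside (suc k) = begin
  ∑ (vecs tff (suc k)) (λ I → ∑ (vecs tff (suc k)) (λ J → outside (I ∩ J)))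
    ≡⟨ ∑-vecs tff k _ ⟩
  ∑ tff (λ i → ∑ W (λ I → ∑ (vecs tff (suc k)) (λ J → outside ((i ∷ I) ∩ J))))
    ≡⟨ ∑-cong tff (λ i → ∑-cong W (λ I → ∑-vecs tff k (λ J → outside ((i ∷ I) ∩ J)))) ⟩
  ∑ tff (λ i → ∑ W (λ I → ∑ tff (λ j → ∑ W (λ J → outside ((i ∷ I) ∩ (j ∷ J))))))
    ≡⟨ cong₂ (λ x y → x + (y + (y + 0)))
        (trans (∑-cong W (λ I → cong (λ z → p I + (z + (z + 0))) (∑-*ˡ W 2 _)))
               (trans (∑-cong W (λ I → 1+2+2 (p I))) (∑-*ˡ W 5 p)))
        (trans (∑-cong W (λ I → cong (λ z → z + (z + (z + 0))) (∑-*ˡ W 2 _)))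
               (trans (∑-cong W (λ I → 2+2+2 (p I))) (∑-*ˡ W 6 p))) ⟩
  5 * ∑ W p + (6 * ∑ W p + (6 * ∑ W p + 0))
    ≡⟨ 5+6+6 (∑ W p) ⟩
  17 * ∑ W p
    ≡⟨ cong (17 *_) (∑∑-outside k) ⟩
  17 * 17 ^ k ∎
  where
  open ≡-Reasoning
  W = vecs tff k
  p : Vec Bool k → ℕ
  p I = ∑ W (λ J → outside (I ∩ J))
  1+2+2 : ∀ x → x + (2 * x + (2 * x + 0)) ≡ 5 * x
  1+2+2 = solve-∀
  2+2+2 : ∀ x → 2 * x + (2 * x + (2 * x + 0)) ≡ 6 * x
  2+2+2 = solve-∀
  5+6+6 : ∀ x → 5 * x + (6 * x + (6 * x + 0)) ≡ 17 * x
  5+6+6 = solve-∀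

module _ {m : ℕ} (i₀ : Fin m) where

  -- The coordinates outside the set are compared one after another until a difference appears; `ι`
  -- places the remaining coordinates in the full vector.
  diff : ∀ {k} → Vec Bool k → (Fin k → Fin m) → KWProtocol m
  -- The default answer `i₀` is reached only when the inputs agree outside the set.
  diff [] ι = leaf i₀
  diff (true ∷ S) ι = diff S (ι ∘ suc)
  diff (false ∷ S) ι =
    alice (λ x → x (ι zero))
      (bob (λ y → y (ι zero)) (diff S (ι ∘ suc)) (leaf (ι zero)))
      (bob (λ y → y (ι zero)) (leaf (ι zero)) (diff S (ι ∘ suc)))

  -- Each compared coordinate turns l leaves into 2 l + 2, so l + 2 doubles, starting from 3.
  leaves-diff : ∀ {k} (S : Vec Bool k) (ι : Fin k → Fin m) → leaves (diff S ι) + 2 ≡ 3 * outside S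
  leaves-diff [] ι = refl
  leaves-diff (true ∷ S) ι = leaves-diff S (ι ∘ suc)
  leaves-diff (false ∷ S) ι =
    trans (double (leaves (diff S (ι ∘ suc))))
      (trans (cong (2 *_) (leaves-diff S (ι ∘ suc))) (2*3 (outside S)))
    where
    double : ∀ l → l + 1 + (1 + l) + 2 ≡ 2 * (l + 2)
    double = solve-∀
    2*3 : ∀ o → 2 * (3 * o) ≡ 3 * (2 * o)
    2*3 = solve-∀

  diff-correct : ∀ {k} (S : Vec Bool k) (ι : Fin k → Fin m) (x y : BVec m) →
    (x (run (diff S ι) x y) ≢ y (run (diff S ι) x y)) ⊎
    (∀ i → lookup S i ≡ false → x (ι i) ≡ y (ι i))
  diff-correct [] ι x y = inj₂ λ ()
  diff-correct (true ∷ S) ι x y with diff-correct S (ι ∘ suc) x y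
  ... | inj₁ c = inj₁ c
  ... | inj₂ c = inj₂ λ { (suc i) → c i }
  diff-correct (false ∷ S) ι x y with x (ι zero) in ex
  diff-correct (false ∷ S) ι x y | true with y (ι zero) in ey
  ... | false = inj₁ λ e → true≢false ex (trans e ey)
  ... | true with diff-correct S (ι ∘ suc) x y
  ...   | inj₁ c = inj₁ c
  ...   | inj₂ c = inj₂ λ { zero _ → trans ex (sym ey) ; (suc i) → c i }
  diff-correct (false ∷ S) ι x y | false with y (ι zero) in ey
  ... | true = inj₁ λ e → true≢false ey (trans (sym e) ex)
  ... | false with diff-correct S (ι ∘ suc) x y
  ...   | inj₁ c = inj₁ c
  ...   | inj₂ c = inj₂ λ { zero _ → trans ex (sym ey) ; (suc i) → c i }

-- Protocols assembled from covers.

module _ {m : ℕ} {X : Set} (covers : X → Vec Bool m → Bool) (sub : X → KWProtocol m) where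

  -- The last member of the family is entered without a test, so the leaves add up exactly over the
  -- family; correctness relies on some member covering the input.
  aliceChain : X → List X → KWProtocol m
  aliceChain x [] = sub x
  aliceChain x (z ∷ F) = alice (λ v → covers x (tabulate v)) (aliceChain z F) (sub x)

  bobChain : X → List X → KWProtocol m
  bobChain x [] = sub x
  bobChain x (z ∷ F) = bob (λ v → covers x (tabulate v)) (bobChain z F) (sub x)

  leaves-aliceChain : ∀ x F → leaves (aliceChain x F) ≡ ∑ (x ∷ F) (leaves ∘ sub)
  leaves-aliceChain x [] = sym (+-identityʳ _)
  leaves-aliceChain x (z ∷ F) =
    trans (+-comm _ (leaves (sub x))) (cong (leaves (sub x) +_) (leaves-aliceChain z F))

  leaves-bobChain : ∀ x F → leaves (bobChain x F) ≡ ∑ (x ∷ F) (leaves ∘ sub)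
  leaves-bobChain x [] = sym (+-identityʳ _)
  leaves-bobChain x (z ∷ F) =
    trans (+-comm _ (leaves (sub x))) (cong (leaves (sub x) +_) (leaves-bobChain z F))

  run-aliceChain : ∀ x F a b → missed covers (x ∷ F) (tabulate a) ≡ false →
    ∃ λ w → covers w (tabulate a) ≡ true × run (aliceChain x F) a b ≡ run (sub w) a b
  run-aliceChain x [] a b e with covers x (tabulate a) in ec
  ... | true = x , ec , refl
  run-aliceChain x (z ∷ F) a b e with covers x (tabulate a) in ec
  ... | true = x , ec , refl
  ... | false = run-aliceChain z F a b e

  run-bobChain : ∀ x F a b → missed covers (x ∷ F) (tabulate b) ≡ false →
    ∃ λ w → covers w (tabulate b) ≡ true × run (bobChain x F) a b ≡ run (sub w) a b
  run-bobChain x [] a b e with covers x (tabulate b) in ec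
  ... | true = x , ec , refl
  run-bobChain x (z ∷ F) a b e with covers x (tabulate b) in ec
  ... | true = x , ec , refl
  ... | false = run-bobChain z F a b e

_⊕_ : ∀ {k} → Vec Bool k → Vec Bool k → Vec Bool k
_⊕_ = zipWith _xor_

^-distribʳ-* : ∀ a b n → (a * b) ^ n ≡ a ^ n * b ^ n
^-distribʳ-* a b zero = refl
^-distribʳ-* a b (suc n) rewrite ^-distribʳ-* a b n = interchange a b (a ^ n) (b ^ n)
  where
  interchange : ∀ a b c d → a * b * (c * d) ≡ a * c * (b * d)
  interchange = solve-∀

-- If no pair wins on the coordinates where it differs, then the pairs covered by I and J
-- differ outside I ∩ J, and each coordinate contributes a factor 17/9 to the average cost.
module _ {U : Set} (K : List U) (K≢[] : 1 ≤ length K) {m : ℕ} (i₀ : Fin m)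
  (A B : Vec Bool m → Bool) (χ ψ : Vec Bool m → Vec U m → Bool) (S T : ℕ) (S≥1 : 1 ≤ S) (T≥1 : 1 ≤ T)
  (χ-large : ∀ a → A a ≡ true → length K ^ m ≤ S * count K (χ a))
  (ψ-large : ∀ b → B b ≡ true → length K ^ m ≤ T * count K (ψ b))
  (no-pair : ∀ a b → A a ≡ true → B b ≡ true →
    win K (a ⊕ b) (χ a) ≡ true → win K (a ⊕ b) (ψ b) ≡ true → ⊥) where

  private
    M^m≢0 = m^n≢0 (length K) m {{>-nonZero K≢[]}}

    W = vecs tff m
    L = vecs bools m

    cost : Vec Bool m → Vec Bool m → ℕ
    cost I J = 3 * outside (I ∩ J)

    coversχ coversψ : Vec Bool m → Vec Bool m → Bool
    coversχ I a = win K I (χ a)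
    coversψ J b = win K J (ψ b)

    L< : length L < 2 ^ suc m
    L< = subst (_< 2 ^ suc m) (sym (length-vecs bools m)) (^-monoʳ-< 2 ≤-refl {m} ≤-refl)

    W≢[] : 1 ≤ length W
    W≢[] = subst (1 ≤_) (sym (length-vecs tff m)) (m^n>0 3 m)

    -- `win-count` turns density 1/R among the tuples into winning on a 1/R fraction of the list
    -- `W`.
    dense : ∀ (R : ℕ) (φ : Vec U m → Bool) → length K ^ m ≤ R * count K φ →
      length W ≤ R * ∑ W (λ I → ⟦ win K I φ ⟧)
    dense R φ le rewrite length-vecs tff m =
      *-cancelʳ-≤ (3 ^ m) _ (length K ^ m) {{M^m≢0}} (begin
        3 ^ m * length K ^ m
          ≤⟨ *-monoʳ-≤ (3 ^ m) le ⟩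
        3 ^ m * (R * count K φ)
          ≡⟨ x∙yz≡y∙xz (3 ^ m) R _ ⟩
        R * (3 ^ m * count K φ)
          ≤⟨ *-monoʳ-≤ R (win-count K φ) ⟩
        R * (length K ^ m * ∑ W (λ I → ⟦ win K I φ ⟧))
          ≡⟨ rearrange R (length K ^ m) _ ⟩
        R * ∑ W (λ I → ⟦ win K I φ ⟧) * length K ^ m ∎)
      where
      open ≤-Reasoning
      x∙yz≡y∙xz : ∀ x y z → x * (y * z) ≡ y * (x * z)
      x∙yz≡y∙xz = solve-∀
      rearrange : ∀ x y z → x * (y * z) ≡ x * z * y
      rearrange = solve-∀

    Separates : KWProtocol m → Set
    Separates Q = ∀ x y → A (tabulate x) ≡ true → B (tabulate y) ≡ true → x (run Q x y) ≢ y (run Q x y)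

    -- The two covers contribute 2 (m + 1) S and 2 (m + 1) T, and the costs of all pairs sum to 3 *
    -- 17 ^ m; this gives the constant 12.
    bound : ℕ
    bound = 12 * (suc m * suc m) * 17 ^ m * (S * T)

    Result : Set
    Result = Σ (KWProtocol m) λ Q → Separates Q × leaves Q * (3 ^ m * 3 ^ m) ≤ bound

    -- Handles an empty cover, where one player has no input left. A single leaf fits the bound
    -- because 9 ≤ 17.
    trivial : Separates (leaf i₀) → Result
    trivial sep = leaf i₀ , sep , (begin
      1 * (3 ^ m * 3 ^ m)
        ≡⟨ trans (*-identityˡ _) (sym (^-distribʳ-* 3 3 m)) ⟩
      9 ^ m
        ≤⟨ ^-monoˡ-≤ m (≤ᵇ⇒≤ 9 17 tt) ⟩
      17 ^ m
        ≡⟨ trans (sym (*-identityʳ _)) (cong (_* 1) (sym (*-identityˡ (17 ^ m)))) ⟩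
      1 * 17 ^ m * 1
        ≤⟨ *-mono-≤ (*-monoˡ-≤ (17 ^ m) {1} {12 * (suc m * suc m)} (s≤s z≤n)) (*-mono-≤ S≥1 T≥1) ⟩
      12 * (suc m * suc m) * 17 ^ m * (S * T) ∎)
      where open ≤-Reasoning

    cost-total : ∑ W (λ I → ∑ W (cost I)) ≡ 3 * 17 ^ m
    cost-total = trans (∑-cong W (λ I → ∑-*ˡ W 3 _)) (trans (∑-*ˡ W 3 _) (cong (3 *_) (∑∑-outside m)))

    cost≥1 : ∀ I J → 1 ≤ cost I J
    cost≥1 I J = *-mono-≤ {1} {3} (s≤s z≤n) (outside≥1 (I ∩ J))

    ∑cost≥1 : ∀ I F J → 1 ≤ ∑ (I ∷ F) (λ I → cost I J)
    ∑cost≥1 I F J = ≤-trans (cost≥1 I J) (m≤m+n _ _)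

    ∑W-cost≥1 : ∀ I → 1 ≤ ∑ W (cost I)
    ∑W-cost≥1 I = ≤-trans W≢[]
      (≤-trans (≤-reflexive (sym (∑-1 W))) (∑-mono W (cost≥1 I)))

    -- Inputs that agree outside I ∩ J have their difference set inside both I and J, so by `win-⊆`
    -- both would win on it, against `no-pair`.
    disjoint : ∀ I J x y → A (tabulate x) ≡ true → B (tabulate y) ≡ true →
      coversχ I (tabulate x) ≡ true → coversψ J (tabulate y) ≡ true →
      (∀ i → lookup (I ∩ J) i ≡ false → x i ≡ y i) → ⊥
    disjoint I J x y Ax By cI cJ agree =
      no-pair _ _ Ax By
        (win-⊆ K K≢[] (tabulate x ⊕ tabulate y) I _ (λ i d → proj₁ (both i d)) cI)
        (win-⊆ K K≢[] (tabulate x ⊕ tabulate y) J _ (λ i d → proj₂ (both i d)) cJ)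
      where
      xor-irrefl : ∀ b → b xor b ≡ false
      xor-irrefl true = refl
      xor-irrefl false = refl
      D-lookup : ∀ i → lookup (tabulate x ⊕ tabulate y) i ≡ x i xor y i
      D-lookup i = trans (lookup-zipWith _xor_ i (tabulate x) (tabulate y))
                         (cong₂ _xor_ (lookup∘tabulate x i) (lookup∘tabulate y i))
      both : ∀ i → lookup (tabulate x ⊕ tabulate y) i ≡ true → lookup I i ≡ true × lookup J i ≡ true
      both i d with lookup (I ∩ J) i in e
      ... | true = ∧-true⁻ (trans (sym (lookup-zipWith _∧_ i I J)) e)
      ... | false = ⊥-elim (true≢false d (trans (D-lookup i)
                      (trans (cong (_xor y i) (agree i e)) (xor-irrefl (y i)))))

    -- Alice names a set I covering her input, Bob a set J covering his, and the inputs are compared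
    -- outside I ∩ J, where `disjoint` forces a difference.
    assemble : ∀ I F J G →
      (∀ {a} → a ∈ L → A a ≡ true → missed coversχ (I ∷ F) a ≡ false) →
      (∀ {b} → b ∈ L → B b ≡ true → missed coversψ (J ∷ G) b ≡ false) →
      Σ (KWProtocol m) λ Q → Separates Q × leaves Q ≤ ∑ (J ∷ G) (λ J → ∑ (I ∷ F) (λ I → cost I J))
    assemble I F J G covA covB = Q , sep , size
      where
      inner : Vec Bool m → Vec Bool m → KWProtocol m
      inner I J = diff i₀ (I ∩ J) (λ i → i)
      middle : Vec Bool m → KWProtocol m
      middle I = bobChain coversψ (inner I) J G
      Q : KWProtocol m
      Q = aliceChain coversχ middle I F
      sep : Separates Q
      sep x y Ax By
        with run-aliceChain coversχ middle I F x y (covA (∈-vecs bools ∈-bools _) Ax)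
      ... | I' , cI , eI with run-bobChain coversψ (inner I') J G x y (covB (∈-vecs bools ∈-bools _) By)
      ...   | J' , cJ , eJ with diff-correct i₀ (I' ∩ J') (λ i → i) x y
      ...     | inj₁ ok = subst (λ i → x i ≢ y i) (sym (trans eI eJ)) ok
      ...     | inj₂ agree = ⊥-elim (disjoint I' J' x y Ax By cI cJ agree)
      size : leaves Q ≤ ∑ (J ∷ G) (λ J → ∑ (I ∷ F) (λ I → cost I J))
      size = begin
        leaves Q
          ≡⟨ leaves-aliceChain coversχ middle I F ⟩
        ∑ (I ∷ F) (λ I → leaves (middle I))
          ≡⟨ ∑-cong (I ∷ F) (λ I → leaves-bobChain coversψ (inner I) J G) ⟩
        ∑ (I ∷ F) (λ I → ∑ (J ∷ G) (λ J → leaves (inner I J)))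
          ≤⟨ ∑-mono (I ∷ F) (λ I → ∑-mono (J ∷ G) (λ J →
               ≤-trans (m≤m+n _ 2) (≤-reflexive (leaves-diff i₀ (I ∩ J) (λ i → i))))) ⟩
        ∑ (I ∷ F) (λ I → ∑ (J ∷ G) (cost I))
          ≡⟨ ∑-swap (I ∷ F) (J ∷ G) cost ⟩
        ∑ (J ∷ G) (λ J → ∑ (I ∷ F) (λ I → cost I J)) ∎
        where open ≤-Reasoning

    combine : ∀ l cF cG s → l ≤ cG → cF * s ≤ 2 * suc m * (S * (3 * 17 ^ m)) →
      cG * s ≤ 2 * suc m * (T * cF) → l * (s * s) ≤ bound
    combine l cF cG s l≤ F≤ G≤ = begin
      l * (s * s)
        ≤⟨ *-monoˡ-≤ (s * s) l≤ ⟩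
      cG * (s * s)
        ≡⟨ sym (*-assoc cG s s) ⟩
      cG * s * s
        ≤⟨ *-monoˡ-≤ s G≤ ⟩
      2 * suc m * (T * cF) * s
        ≡⟨ e₁ (suc m) T cF s ⟩
      2 * suc m * T * (cF * s)
        ≤⟨ *-monoʳ-≤ (2 * suc m * T) F≤ ⟩
      2 * suc m * T * (2 * suc m * (S * (3 * 17 ^ m)))
        ≡⟨ e₂ (suc m) T S (17 ^ m) ⟩
      12 * (suc m * suc m) * 17 ^ m * (S * T) ∎
      where
      open ≤-Reasoning
      e₁ : ∀ m t c s → 2 * m * (t * c) * s ≡ 2 * m * t * (c * s)
      e₁ = solve-∀
      e₂ : ∀ m t s x → 2 * m * t * (2 * m * (s * (3 * x))) ≡ 12 * (m * m) * x * (s * t)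
      e₂ = solve-∀

  -- Alice's cover is found first, each I priced by its total cost against all J. Bob's cover then
  -- prices each J by its cost against the sets already chosen. The prices of all J sum to the price
  -- of Alice's cover, so the two guarantees multiply.
  coverProtocol : Result
  coverProtocol
    with cover W W≢[] L coversχ S (λ I → ∑ W (cost I)) ∑W-cost≥1 (suc m) A L<
           (λ a Aa → dense S (χ a) (χ-large a Aa))
  ... | [] , covA , _ =
    trivial λ x y Ax _ → ⊥-elim (true≢false refl (covA (∈-vecs bools ∈-bools (tabulate x)) Ax))
  ... | I ∷ F , covA , costF
    with cover W W≢[] L coversψ T (λ J → ∑ (I ∷ F) (λ I → cost I J)) (∑cost≥1 I F) (suc m) B L<
           (λ b Bb → dense T (ψ b) (ψ-large b Bb))
  ...   | [] , covB , _ =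
    trivial λ x y _ By → ⊥-elim (true≢false refl (covB (∈-vecs bools ∈-bools (tabulate y)) By))
  ...   | J ∷ G , covB , costG with assemble I F J G covA covB
  ...     | Q , sep , size =
    Q , sep , combine (leaves Q) (∑ (I ∷ F) (λ I → ∑ W (cost I))) _ (3 ^ m) size
      (subst₂ (λ s c → ∑ (I ∷ F) (λ I → ∑ W (cost I)) * s ≤ 2 * suc m * (S * c))
        (length-vecs tff m) cost-total costF)
      (subst₂ (λ s c → ∑ (J ∷ G) (λ J → ∑ (I ∷ F) (λ I → cost I J)) * s ≤ 2 * suc m * (T * c))
        (length-vecs tff m) (∑-swap W (I ∷ F) (λ J I → cost I J)) costG)

-- The inner functions and the adversary argument

-- A perfect binary tree, so that all tables can be listed and sums over them factor point by point.
TruthTable : ℕ → Set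
TruthTable zero = Bool
TruthTable (suc n) = TruthTable n × TruthTable n

at : ∀ {n} → TruthTable n → Vec Bool n → Bool
at h [] = h
at (h₀ , h₁) (true ∷ u) = at h₁ u
at (h₀ , h₁) (false ∷ u) = at h₀ u

-- Every value is taken by exactly one extension of each tail, so g is exactly balanced.
inner : ∀ {n} → TruthTable n → BVec (suc n) → Bool
inner h x = x zero xor at h (tabulate (x ∘ suc))

points : ∀ n → List (Vec Bool n)
points = vecs bools

length-points : ∀ n → length (points n) ≡ 2 ^ n
length-points = length-vecs bools

points≢[] : ∀ n → 1 ≤ length (points n)
points≢[] n = subst (1 ≤_) (sym (length-points n)) (m^n>0 2 n)

Rows : ℕ → ℕ → Set
Rows m n = Vec (Vec Bool n) m

entry : ∀ {m n} → Rows m n → Fin m → Fin n → Bool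
entry X i j = lookup (lookup X i) j

module _ {n : ℕ} (h : TruthTable n) where

  -- The unique row with tail `u` on which `inner h` takes the value `a`.
  row : Bool → Vec Bool n → Vec Bool (suc n)
  row a u = (at h u xor a) ∷ u

  rows : ∀ {m} → Vec Bool m → Rows m n → Rows m (suc n)
  rows = zipWith row

  inner-row : ∀ a u → inner h (lookup (row a u)) ≡ a
  inner-row a u = trans (cong (λ v → (at h u xor a) xor at h v) (tabulate∘lookup u)) (cancel (at h u) a)
    where
    cancel : ∀ c a → (c xor a) xor c ≡ a
    cancel true true = refl
    cancel true false = refl
    cancel false true = refl
    cancel false false = refl

  inner-rows : ∀ {m} (a : Vec Bool m) (v : Rows m n) i → inner h (entry (rows a v) i) ≡ lookup a i
  inner-rows a v i =
    trans (cong (inner h ∘ lookup) (lookup-zipWith row i a v)) (inner-row (lookup a i) (lookup v i))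

blank : ∀ {n} → Vec Bool n
blank = replicate _ false

-- After masking, a formula depends only on the rows in the set, and both players can arrive at the
-- same matrix.
mask : ∀ {m n} → Vec Bool m → Rows m n → Rows m n
mask = zipWith (λ d r → if d then r else blank)

entry-mask : ∀ {m n} (D : Vec Bool m) (X : Rows m n) i j → lookup D i ≡ true →
  entry (mask D X) i j ≡ entry X i j
entry-mask D X i j e =
  cong (λ r → lookup r j) (trans (lookup-zipWith _ i D X) (cong (λ d → if d then lookup X i else blank) e))

-- Outside D the row is blank, so the one winning value that win asks for there is not recorded.
wins : ∀ {n m} → TruthTable n → Vec Bool m → Vec Bool m → (Rows m (suc n) → Bool) → Bool
wins h [] [] s = s []
wins {n} h (a ∷ as) (true ∷ D) s =
  2 * length (points n) ≤ᵇ 3 * ∑ (points n) (λ u → ⟦ wins h as D (λ X → s (row h a u ∷ X)) ⟧)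
wins h (a ∷ as) (false ∷ D) s = wins h as D (λ X → s (blank ∷ X))

-- Outside `D` the masked row is blank whichever tail is chosen, so any tail supplied by `win` will
-- do; on `D` the same tails are counted.
win⇒wins : ∀ {n m} (h : TruthTable n) (a D : Vec Bool m) (χ : Rows m n → Bool) (s : Rows m (suc n) → Bool) →
  (∀ v → χ v ≡ true → s (mask D (rows h a v)) ≡ true) →
  win (points n) D χ ≡ true → wins h a D s ≡ true
win⇒wins h [] [] χ s χ⇒s w = χ⇒s [] w
win⇒wins {n} h (a ∷ as) (true ∷ D) χ s χ⇒s w =
  ≤ᵇ-true⁺ {2 * length (points n)} (≤-trans (≤ᵇ-true⁻ {2 * length (points n)} w)
    (*-monoʳ-≤ 3 (∑-mono (points n) (λ u →
      ⟦⟧-mono (win⇒wins h as D _ _ (λ v → χ⇒s (u ∷ v)))))))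
win⇒wins {n} h (a ∷ as) (false ∷ D) χ s χ⇒s w
  with ∑-exists-< (points n) (λ _ → 0) (λ u → ⟦ win (points n) D (λ v → χ (u ∷ v)) ⟧)
         (≤-trans (s≤s (≤-reflexive (trans (∑-const (points n) 0) (*-zeroʳ (length (points n))))))
                  (≤ᵇ-true⁻ w))
... | u , lt = win⇒wins h as D _ _ (λ v → χ⇒s (u ∷ v)) (⟦⟧-true lt)

-- Formulas and their extraction from protocols.

data Formula (m n : ℕ) : ℕ → Set where
  const : Bool → Formula m n 0
  lit   : Bool → Fin m → Fin n → Formula m n 0
  and   : ∀ {e} → Formula m n e → Formula m n e → Formula m n (suc e)
  or    : ∀ {e} → Formula m n e → Formula m n e → Formula m n (suc e)

eval : ∀ {m n e} → Formula m n e → Rows m n → Bool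
eval (const b) X = b
eval (lit b i j) X = b xor entry X i j
eval (and s t) X = eval s X ∧ eval t X
eval (or s t) X = eval s X ∨ eval t X

module _ {A B O : Set} (q : A → Bool) (l r : Protocol A B O) {x : A} {y : B} where

  run-alice-true : q x ≡ true → run (alice q l r) x y ≡ run r x y
  run-alice-true e with q x | e
  ... | true | _ = refl

  run-alice-false : q x ≡ false → run (alice q l r) x y ≡ run l x y
  run-alice-false e with q x | e
  ... | false | _ = refl

module _ {A B O : Set} (q : B → Bool) (l r : Protocol A B O) {x : A} {y : B} where

  run-bob-true : q y ≡ true → run (bob q l r) x y ≡ run r x y
  run-bob-true e with q y | e
  ... | true | _ = refl

  run-bob-false : q y ≡ false → run (bob q l r) x y ≡ run l x y
  run-bob-false e with q y | e
  ... | false | _ = refl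

⊔-≤⁻ : ∀ {a b c} → a ⊔ b ≤ c → a ≤ c × b ≤ c
⊔-≤⁻ {a} {b} p = ≤-trans (m≤m⊔n a b) p , ≤-trans (m≤n⊔m a b) p

∨-true : ∀ {a b} c → (c ≡ true → b ≡ true) → (c ≡ false → a ≡ true) → a ∨ b ≡ true
∨-true {true} c p q = refl
∨-true {false} true p q = p refl
∨-true {false} false p q with q refl
... | ()

∧-false : ∀ {a b} c → (c ≡ true → b ≡ false) → (c ≡ false → a ≡ false) → a ∧ b ≡ false
∧-false {false} c p q = refl
∧-false {true} true p q = p refl
∧-false {true} false p q with q refl
... | ()

not-true⁺ : ∀ {b} → b ≡ false → not b ≡ true
not-true⁺ refl = refl

-- The usual passage from protocols to formulas; literals in rows of D survive the masking.
module _ {m n : ℕ} {Z : Set} (E : List Z) (E-all : ∀ z → z ∈ E) (D : Vec Bool m)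
         (X Y : Z → Rows m n) where

  Finds : Fin m × Fin n → Z → Z → Set
  Finds (i , j) u v = lookup D i ≡ true × entry (X u) i j ≢ entry (Y v) i j

  Splits : ∀ {e} → Formula m n e → (χ ψ : Z → Bool) → Set
  Splits s χ ψ = (∀ u → χ u ≡ true → eval s (mask D (X u)) ≡ true) ×
                 (∀ v → ψ v ≡ true → eval s (mask D (Y v)) ≡ false)

  private
    xor-≢ : ∀ {a b} → a ≢ b → b xor a ≡ true
    xor-≢ {true} {true} p = ⊥-elim (p refl)
    xor-≢ {true} {false} p = refl
    xor-≢ {false} {true} p = refl
    xor-≢ {false} {false} p = ⊥-elim (p refl)

    xor-≢≢ : ∀ {a b c} → a ≢ b → a ≢ c → b xor c ≡ false
    xor-≢≢ {true} {true} p q = ⊥-elim (p refl)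
    xor-≢≢ {true} {false} {true} p q = ⊥-elim (q refl)
    xor-≢≢ {true} {false} {false} p q = refl
    xor-≢≢ {false} {false} p q = ⊥-elim (p refl)
    xor-≢≢ {false} {true} {true} p q = refl
    xor-≢≢ {false} {true} {false} p q = ⊥-elim (q refl)

    split-leaf : ∀ o (χ ψ : Z → Bool) → (∀ u v → χ u ≡ true → ψ v ≡ true → Finds o u v) →
      Σ (Formula m n 0) λ s → Splits s χ ψ
    split-leaf (i , j) χ ψ ok with search χ E
    ... | inj₂ none = const false , (λ u p → ⊥-elim (true≢false p (none (E-all u)))) , λ _ _ → refl
    ... | inj₁ (u , χu) with search ψ E
    ...   | inj₂ none = const true , (λ _ _ → refl) , λ v p → ⊥-elim (true≢false p (none (E-all v)))
    -- The entry differs on every pair of a nonempty rectangle, so it is constant on each side. The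
    -- sign of the literal is Bob's value, which makes it true for Alice and false for Bob.
    ...   | inj₁ (v , ψv) = lit (entry (Y v) i j) i j , onX , onY
      where
      i∈D : lookup D i ≡ true
      i∈D = proj₁ (ok u v χu ψv)
      onX : ∀ u → χ u ≡ true → entry (Y v) i j xor entry (mask D (X u)) i j ≡ true
      onX u' p = trans (cong (entry (Y v) i j xor_) (entry-mask D (X u') i j i∈D))
                       (xor-≢ (proj₂ (ok u' v p ψv)))
      onY : ∀ v' → ψ v' ≡ true → entry (Y v) i j xor entry (mask D (Y v')) i j ≡ false
      onY v' p = trans (cong (entry (Y v) i j xor_) (entry-mask D (Y v') i j i∈D))
                       (xor-≢≢ (proj₂ (ok u v χu ψv)) (proj₂ (ok u v' χu p)))

  -- Alice's nodes become `or` and Bob's become `and`; `χ` and `ψ` describe the rectangle of inputs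
  -- that reach the node.
  protocol⇒formula : ∀ e (P : Protocol (BMat m n) (BMat m n) (Fin m × Fin n)) (χ ψ : Z → Bool) →
    depth P ≤ e →
    (∀ u v → χ u ≡ true → ψ v ≡ true → Finds (run P (entry (X u)) (entry (Y v))) u v) →
    Σ (Formula m n e) λ s → Splits s χ ψ
  protocol⇒formula zero (leaf o) χ ψ _ ok = split-leaf o χ ψ ok
  -- Early leaves are padded to exact depth `e`, which keeps the count of formulas a plain squaring
  -- recursion.
  protocol⇒formula (suc e) (leaf o) χ ψ _ ok with protocol⇒formula e (leaf o) χ ψ z≤n ok
  ... | s , onX , onY = and s s , (λ u p → ∧-true⁺ (onX u p) (onX u p)) ,
                        (λ v p → ∧-false true (λ _ → onY v p) λ ())
  protocol⇒formula (suc e) (alice q l r) χ ψ (s≤s d) ok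
    with protocol⇒formula e l (λ u → χ u ∧ not (q (entry (X u)))) ψ (proj₁ (⊔-≤⁻ d))
           (λ u v p p' → let χu , qu = ∧-true⁻ p in
             subst (λ o → Finds o u v) (run-alice-false q l r (not-true⁻ qu)) (ok u v χu p'))
       | protocol⇒formula e r (λ u → χ u ∧ q (entry (X u))) ψ (proj₂ (⊔-≤⁻ d))
           (λ u v p p' → let χu , qu = ∧-true⁻ p in
             subst (λ o → Finds o u v) (run-alice-true q l r qu) (ok u v χu p'))
  ... | s , sX , sY | t , tX , tY = or s t ,
    (λ u p → ∨-true (q (entry (X u))) (λ e → tX u (∧-true⁺ p e)) (λ e → sX u (∧-true⁺ p (not-true⁺ e)))) ,
    (λ v p → subst₂ (λ a b → a ∨ b ≡ false) (sym (sY v p)) (sym (tY v p)) refl)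
  protocol⇒formula (suc e) (bob q l r) χ ψ (s≤s d) ok
    with protocol⇒formula e l χ (λ v → ψ v ∧ not (q (entry (Y v)))) (proj₁ (⊔-≤⁻ d))
           (λ u v p p' → let ψv , qv = ∧-true⁻ p' in
             subst (λ o → Finds o u v) (run-bob-false q l r (not-true⁻ qv)) (ok u v p ψv))
       | protocol⇒formula e r χ (λ v → ψ v ∧ q (entry (Y v))) (proj₂ (⊔-≤⁻ d))
           (λ u v p p' → let ψv , qv = ∧-true⁻ p' in
             subst (λ o → Finds o u v) (run-bob-true q l r qv) (ok u v p ψv))
  ... | s , sX , sY | t , tX , tY = and s t ,
    (λ u p → ∧-true⁺ (sX u p) (tX u p)) ,
    (λ v p → ∧-false (q (entry (Y v))) (λ e → tY v (∧-true⁺ p e)) (λ e → sY v (∧-true⁺ p (not-true⁺ e))))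

-- Good codes and the simulation of the first rounds.

Code : ℕ → ℕ → ℕ → Set
Code m n e = Vec Bool m × Vec Bool m × Formula m (suc n) e

-- The event to be avoided when `h` is chosen: one formula of depth `e` serves both inputs of a pair
-- on their difference set.
good : ∀ {m n e} → TruthTable n → Code m n e → Bool
good h (a , b , s) = wins h a (a ⊕ b) (eval s) ∧ wins h b (a ⊕ b) (not ∘ eval s)

module _ {m n : ℕ} (h : TruthTable n) (i₀ : Fin m) (e : ℕ) where

  private
    K = points n
    Z = Rows m n

    MatProtocol : Set
    MatProtocol = Protocol (BMat m (suc n)) (BMat m (suc n)) (Fin m × Fin (suc n))

    E : List Z
    E = vecs K m

    E-all : ∀ z → z ∈ E
    E-all = ∈-vecs K (∈-vecs bools ∈-bools)

    Ok : (a b : Vec Bool m) → Fin m × Fin (suc n) → Z → Z → Set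
    Ok a b = Finds E E-all (a ⊕ b) (rows h a) (rows h b)

    answer : MatProtocol → (a b : Vec Bool m) → Z → Z → Fin m × Fin (suc n)
    answer P a b u v = run P (entry (rows h a u)) (entry (rows h b v))

    Family : Set
    Family = Vec Bool m → Z → Bool

    Solved : MatProtocol → (A B : Vec Bool m → Bool) → (χ ψ : Family) → Set
    Solved P A B χ ψ = ∀ a b u v → A a ≡ true → B b ≡ true → χ a u ≡ true → ψ b v ≡ true →
      Ok a b (answer P a b u v) u v

    Large : ℕ → (Vec Bool m → Bool) → Family → Set
    Large S A χ = ∀ a → A a ≡ true → length K ^ m ≤ S * count K (χ a)

    Separates : (A B : Vec Bool m → Bool) → KWProtocol m → Set
    Separates A B Q =
      ∀ x y → A (tabulate x) ≡ true → B (tabulate y) ≡ true → x (run Q x y) ≢ y (run Q x y)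

    factor : ℕ
    factor = 12 * (suc m * suc m) * 17 ^ m

    Result : (A B : Vec Bool m → Bool) → ℕ → Set
    Result A B c = (∃ λ (code : Code m n e) → good h code ≡ true) ⊎
      Σ (KWProtocol m) λ Q → Separates A B Q × leaves Q * (3 ^ m * 3 ^ m) ≤ factor * c

  winning-pair⇒good : ∀ P a b (χ ψ : Z → Bool) → depth P ≤ e →
    (∀ u v → χ u ≡ true → ψ v ≡ true → Ok a b (answer P a b u v) u v) →
    win K (a ⊕ b) χ ≡ true → win K (a ⊕ b) ψ ≡ true →
    ∃ λ (code : Code m n e) → good h code ≡ true
  winning-pair⇒good P a b χ ψ d ok wχ wψ
    with protocol⇒formula E E-all (a ⊕ b) (rows h a) (rows h b) e P χ ψ d ok
  ... | s , sX , sY = (a , b , s) ,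
    ∧-true⁺ (win⇒wins h a (a ⊕ b) χ (eval s) sX wχ)
            (win⇒wins h b (a ⊕ b) ψ (not ∘ eval s) (λ v p → not-true⁺ (sY v p)) wψ)

  private
    base : ∀ P A B χ ψ S T → depth P ≤ e → 1 ≤ S → 1 ≤ T → Large S A χ → Large T B ψ →
      Solved P A B χ ψ → Result A B (S * T)
    base P A B χ ψ S T d S≥1 T≥1 Lχ Lψ ok
      with search (λ ab → let a , b = ab in
             (A a ∧ B b) ∧ (win K (a ⊕ b) (χ a) ∧ win K (a ⊕ b) (ψ b)))
             (cartesianProductWith _,_ (vecs bools m) (vecs bools m))
    ... | inj₁ ((a , b) , p) =
      let AB , w = ∧-true⁻ p
          Aa , Bb = ∧-true⁻ AB
          wχ , wψ = ∧-true⁻ w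
      in inj₁ (winning-pair⇒good P a b (χ a) (ψ b) d (λ u v → ok a b u v Aa Bb) wχ wψ)
    ... | inj₂ none = inj₂ (coverProtocol K (points≢[] n) i₀ A B χ ψ S T S≥1 T≥1 Lχ Lψ
      λ a b Aa Bb wχ wψ → true≢false (∧-true⁺ (∧-true⁺ Aa Bb) (∧-true⁺ wχ wψ))
        (none (∈-cartesianProductWith⁺ _,_ (∈-vecs bools ∈-bools a) (∈-vecs bools ∈-bools b))))

    count-split : ∀ (χ q : Z → Bool) →
      count K (λ u → χ u ∧ q u) + count K (λ u → χ u ∧ not (q u)) ≡ count K χ
    count-split χ q = trans (sym (∑-+ E _ _)) (∑-cong E λ u → split (χ u) (q u))
      where
      split : ∀ a b → ⟦ a ∧ b ⟧ + ⟦ a ∧ not b ⟧ ≡ ⟦ a ⟧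
      split true true = refl
      split true false = refl
      split false b = refl

    -- At a node, an input announces the side that keeps at least half of its matrices.
    majority : Family → (BMat m (suc n) → Bool) → Vec Bool m → Bool
    majority χ q a = count K (χ a) ≤ᵇ 2 * count K (λ u → χ a u ∧ q (entry (rows h a u)))

    keep drop : Family → (BMat m (suc n) → Bool) → Family
    keep χ q a u = χ a u ∧ q (entry (rows h a u))
    drop χ q a u = χ a u ∧ not (q (entry (rows h a u)))

    large-keep : ∀ S A χ q → Large S A χ → Large (2 * S) (λ a → A a ∧ majority χ q a) (keep χ q)
    large-keep S A χ q L a p = let Aa , big = ∧-true⁻ p in
      ≤-trans (L a Aa) (≤-trans (*-monoʳ-≤ S (≤ᵇ-true⁻ big)) (≤-reflexive (shift S _)))
      where
      shift : ∀ s c → s * (2 * c) ≡ 2 * s * c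
      shift = solve-∀

    large-drop : ∀ S A χ q → Large S A χ → Large (2 * S) (λ a → A a ∧ not (majority χ q a)) (drop χ q)
    large-drop S A χ q L a p = let Aa , small = ∧-true⁻ p in
      ≤-trans (L a Aa) (≤-trans (*-monoʳ-≤ S (half (≤ᵇ-false⁻ (not-true⁻ small))))
                                (≤-reflexive (shift S _)))
      where
      shift : ∀ s c → s * (2 * c) ≡ 2 * s * c
      shift = solve-∀
      k = count K (keep χ q a)
      d = count K (drop χ q a)
      half : 2 * k < count K (χ a) → count K (χ a) ≤ 2 * d
      half lt = +-cancelˡ-≤ (2 * k) _ _ (begin
        2 * k + count K (χ a)      ≤⟨ +-monoˡ-≤ (count K (χ a)) (<⇒≤ lt) ⟩
        count K (χ a) + count K (χ a) ≡⟨ cong (λ c → c + c) (sym (count-split (χ a) (q ∘ entry ∘ rows h a))) ⟩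
        (k + d) + (k + d)          ≡⟨ double k d ⟩
        2 * k + 2 * d              ∎)
        where
        open ≤-Reasoning
        double : ∀ a b → (a + b) + (a + b) ≡ 2 * a + 2 * b
        double = solve-∀

    halves : ∀ x y s c d → x * s ≤ factor * c → y * s ≤ factor * c → 2 * c ≡ d → (x + y) * s ≤ factor * d
    halves x y s c d p q refl = ≤-trans (≤-reflexive (*-distribʳ-+ s x y))
      (≤-trans (+-mono-≤ p q) (≤-reflexive (double factor c)))
      where
      double : ∀ f c → f * c + f * c ≡ f * (2 * c)
      double = solve-∀

    costA : ∀ S T t → 2 * (2 * S * T * t) ≡ S * T * (4 * t)
    costA = solve-∀

    costB : ∀ S T t → 2 * (S * (2 * T) * t) ≡ S * T * (4 * t)
    costB = solve-∀

    relax : ∀ A B c t → Result A B c → Result A B (c * 4 ^ t)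
    relax A B c t (inj₁ g) = inj₁ g
    relax A B c t (inj₂ (Q , sep , size)) = inj₂ (Q , sep ,
      ≤-trans size (*-monoʳ-≤ factor (≤-trans (≤-reflexive (sym (*-identityʳ c))) (*-monoʳ-≤ c (m^n>0 4 t)))))

  -- The owner of each node announces the majority side of the current input. A round doubles `S` or
  -- `T` and joins two subprotocols, hence a factor 4 per round. At depth `e`, or at an early leaf,
  -- either a winning pair exists or the covers apply.
  descend : ∀ t P A B χ ψ S T → depth P ≤ t + e → 1 ≤ S → 1 ≤ T → Large S A χ → Large T B ψ →
    Solved P A B χ ψ → Result A B (S * T * 4 ^ t)
  descend zero P A B χ ψ S T d S≥1 T≥1 Lχ Lψ ok =
    relax A B (S * T) 0 (base P A B χ ψ S T d S≥1 T≥1 Lχ Lψ ok)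
  descend (suc t) (leaf o) A B χ ψ S T d S≥1 T≥1 Lχ Lψ ok =
    relax A B (S * T) (suc t) (base (leaf o) A B χ ψ S T z≤n S≥1 T≥1 Lχ Lψ ok)
  descend (suc t) (alice q l r) A B χ ψ S T (s≤s d) S≥1 T≥1 Lχ Lψ ok
    with descend t l (λ a → A a ∧ not (majority χ q a)) B (drop χ q) ψ (2 * S) T
           (proj₁ (⊔-≤⁻ d)) (≤-trans S≥1 (m≤m+n S _)) T≥1 (large-drop S A χ q Lχ) Lψ
           (λ a b u v Aa Bb χu ψv → let χu' , qu = ∧-true⁻ χu in
             subst (λ o → Ok a b o u v) (run-alice-false q l r (not-true⁻ qu))
               (ok a b u v (proj₁ (∧-true⁻ Aa)) Bb χu' ψv))
       | descend t r (λ a → A a ∧ majority χ q a) B (keep χ q) ψ (2 * S) T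
           (proj₂ (⊔-≤⁻ d)) (≤-trans S≥1 (m≤m+n S _)) T≥1 (large-keep S A χ q Lχ) Lψ
           (λ a b u v Aa Bb χu ψv → let χu' , qu = ∧-true⁻ χu in
             subst (λ o → Ok a b o u v) (run-alice-true q l r qu)
               (ok a b u v (proj₁ (∧-true⁻ Aa)) Bb χu' ψv))
  ... | inj₁ g | _ = inj₁ g
  ... | inj₂ _ | inj₁ g = inj₁ g
  ... | inj₂ (Q₀ , sep₀ , size₀) | inj₂ (Q₁ , sep₁ , size₁) =
    inj₂ (Q , sep , halves (leaves Q₀) (leaves Q₁) (3 ^ m * 3 ^ m) _ _ size₀ size₁ (costA S T (4 ^ t)))
    where
    Q : KWProtocol m
    Q = alice (λ x → majority χ q (tabulate x)) Q₀ Q₁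
    sep : Separates A B Q
    sep x y Ax By with majority χ q (tabulate x) in maj
    ... | true = sep₁ x y (∧-true⁺ Ax maj) By
    ... | false = sep₀ x y (∧-true⁺ Ax (not-true⁺ maj)) By
  descend (suc t) (bob q l r) A B χ ψ S T (s≤s d) S≥1 T≥1 Lχ Lψ ok
    with descend t l A (λ b → B b ∧ not (majority ψ q b)) χ (drop ψ q) S (2 * T)
           (proj₁ (⊔-≤⁻ d)) S≥1 (≤-trans T≥1 (m≤m+n T _)) Lχ (large-drop T B ψ q Lψ)
           (λ a b u v Aa Bb χu ψv → let ψv' , qv = ∧-true⁻ ψv in
             subst (λ o → Ok a b o u v) (run-bob-false q l r (not-true⁻ qv))
               (ok a b u v Aa (proj₁ (∧-true⁻ Bb)) χu ψv'))
       | descend t r A (λ b → B b ∧ majority ψ q b) χ (keep ψ q) S (2 * T)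
           (proj₂ (⊔-≤⁻ d)) S≥1 (≤-trans T≥1 (m≤m+n T _)) Lχ (large-keep T B ψ q Lψ)
           (λ a b u v Aa Bb χu ψv → let ψv' , qv = ∧-true⁻ ψv in
             subst (λ o → Ok a b o u v) (run-bob-true q l r qv)
               (ok a b u v Aa (proj₁ (∧-true⁻ Bb)) χu ψv'))
  ... | inj₁ g | _ = inj₁ g
  ... | inj₂ _ | inj₁ g = inj₁ g
  ... | inj₂ (Q₀ , sep₀ , size₀) | inj₂ (Q₁ , sep₁ , size₁) =
    inj₂ (Q , sep , halves (leaves Q₀) (leaves Q₁) (3 ^ m * 3 ^ m) _ _ size₀ size₁ (costB S T (4 ^ t)))
    where
    Q : KWProtocol m
    Q = bob (λ y → majority ψ q (tabulate y)) Q₀ Q₁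
    sep : Separates A B Q
    sep x y Ax By with majority ψ q (tabulate y) in maj
    ... | true = sep₁ x y Ax (∧-true⁺ By maj)
    ... | false = sep₀ x y Ax (∧-true⁺ By (not-true⁺ maj))

-- Products over all truth tables

tts : ∀ n → List (TruthTable n)
tts zero = bools
tts (suc n) = cartesianProductWith _,_ (tts n) (tts n)

length-tts : ∀ n → length (tts n) ≡ 2 ^ (2 ^ n)
length-tts zero = refl
length-tts (suc n) =
  trans (length-product _,_ (tts n) (tts n))
  (trans (cong₂ _*_ (length-tts n) (length-tts n))
  (trans (sym (^-distribˡ-+-* 2 (2 ^ n) (2 ^ n)))
         (cong (2 ^_) (cong (2 ^ n +_) (sym (+-identityʳ (2 ^ n)))))))

∏ : ∀ n → (Vec Bool n → ℕ) → ℕ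
∏ zero p = p []
∏ (suc n) p = ∏ n (λ u → p (true ∷ u)) * ∏ n (λ u → p (false ∷ u))

∏-mono : ∀ n {p q : Vec Bool n → ℕ} → (∀ u → p u ≤ q u) → ∏ n p ≤ ∏ n q
∏-mono zero h = h []
∏-mono (suc n) h = *-mono-≤ (∏-mono n (λ u → h (true ∷ u))) (∏-mono n (λ u → h (false ∷ u)))

∏-* : ∀ n (p q : Vec Bool n → ℕ) → ∏ n (λ u → p u * q u) ≡ ∏ n p * ∏ n q
∏-* zero p q = refl
∏-* (suc n) p q = trans (cong₂ _*_ (∏-* n (p ∘ (true ∷_)) (q ∘ (true ∷_)))
                               (∏-* n (p ∘ (false ∷_)) (q ∘ (false ∷_))))
  (interchange (∏ n (p ∘ (true ∷_))) (∏ n (q ∘ (true ∷_))) (∏ n (p ∘ (false ∷_))) _)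
  where
  interchange : ∀ a b c d → a * b * (c * d) ≡ a * c * (b * d)
  interchange = solve-∀

∏-^ : ∀ n c (f : Vec Bool n → ℕ) → ∏ n (λ u → c ^ f u) ≡ c ^ ∑ (points n) f
∏-^ zero c f = cong (c ^_) (sym (+-identityʳ (f [])))
∏-^ (suc n) c f =
  trans (cong₂ _*_ (∏-^ n c (λ u → f (true ∷ u))) (∏-^ n c (λ u → f (false ∷ u))))
  (trans (sym (^-distribˡ-+-* c (∑ (points n) (λ u → f (true ∷ u))) _))
    (cong (c ^_) (sym (trans (∑-vecs bools n f)
      (cong (∑ (points n) (λ u → f (true ∷ u)) +_) (+-identityʳ _))))))

∏-const : ∀ n c → ∏ n (λ _ → c) ≡ c ^ length (points n)
∏-const n c =
  trans (∏-cong n (λ _ → sym (*-identityʳ c)))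
  (trans (∏-^ n c (λ _ → 1)) (cong (c ^_) (∑-1 (points n))))
  where
  ∏-cong : ∀ n {p q : Vec Bool n → ℕ} → (∀ u → p u ≡ q u) → ∏ n p ≡ ∏ n q
  ∏-cong n h = ≤-antisym (∏-mono n (λ u → ≤-reflexive (h u))) (∏-mono n (λ u → ≤-reflexive (sym (h u))))

-- The bits of a uniformly random truth table are independent.
∑-∏ : ∀ n (w : Vec Bool n → Bool → ℕ) →
  ∑ (tts n) (λ h → ∏ n (λ u → w u (at h u))) ≡ ∏ n (λ u → w u true + w u false)
∑-∏ zero w = cong (w [] true +_) (+-identityʳ (w [] false))
∑-∏ (suc n) w = begin
  ∑ (tts (suc n)) (λ h → ∏ (suc n) (λ u → w u (at h u)))
    ≡⟨ ∑-product _,_ (tts n) (tts n) _ ⟩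
  ∑ (tts n) (λ h₀ → ∑ (tts n) (λ h₁ → p₁ h₁ * p₀ h₀))
    ≡⟨ ∑-cong (tts n) (λ h₀ → ∑-*ʳ (tts n) (p₀ h₀) p₁) ⟩
  ∑ (tts n) (λ h₀ → ∑ (tts n) p₁ * p₀ h₀)
    ≡⟨ ∑-*ˡ (tts n) (∑ (tts n) p₁) p₀ ⟩
  ∑ (tts n) p₁ * ∑ (tts n) p₀
    ≡⟨ cong₂ _*_ (∑-∏ n (λ u → w (true ∷ u))) (∑-∏ n (λ u → w (false ∷ u))) ⟩
  ∏ (suc n) (λ u → w u true + w u false) ∎
  where
  open ≡-Reasoning
  p₀ p₁ : TruthTable n → ℕ
  p₀ h = ∏ n (λ u → w (false ∷ u) (at h u))
  p₁ h = ∏ n (λ u → w (true ∷ u) (at h u))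

module _ {n : ℕ} (pop : Vec Bool n → Bool → Bool) where

  private
    K = points n
    M = length K

  degree : Vec Bool n → ℕ
  degree u = ⟦ pop u true ⟧ + ⟦ pop u false ⟧

  weight : Bool → ℕ
  weight b = 2 + ⟦ b ⟧

  -- By independence the sum is the product over the points of 4 plus the degree. `local` bounds
  -- each factor by an exponential in the degree, so only the total degree matters, and degree 1
  -- everywhere gives 5 per point.
  ∑-weights : ∑ K degree ≤ M → ∑ (tts n) (λ h → ∏ n (λ u → weight (pop u (at h u)))) ≤ 5 ^ M
  ∑-weights few rewrite ∑-∏ n (λ u b → weight (pop u b)) =
    *-cancelʳ-≤ _ _ (6 ^ M * 5 ^ M) {{m*n≢0 _ _ {{m^n≢0 6 M}} {{m^n≢0 5 M}}}} (begin
      F * (6 ^ M * 5 ^ M)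
        ≡⟨ cong (λ z → F * (6 ^ M * 5 ^ z)) (sym (m+[n∸m]≡n few)) ⟩
      F * (6 ^ M * 5 ^ (P + k))
        ≡⟨ trans (cong (λ z → F * (6 ^ M * z)) (^-distribˡ-+-* 5 P k)) (regroup F (6 ^ M) (5 ^ P) (5 ^ k)) ⟩
      F * (6 ^ M * 5 ^ P) * 5 ^ k
        ≤⟨ *-mono-≤ total (^-monoˡ-≤ k (≤ᵇ⇒≤ 5 6 tt)) ⟩
      25 ^ M * 6 ^ P * 6 ^ k
        ≡⟨ trans (*-assoc (25 ^ M) (6 ^ P) (6 ^ k)) (cong (25 ^ M *_) (sym (^-distribˡ-+-* 6 P k))) ⟩
      25 ^ M * 6 ^ (P + k)
        ≡⟨ cong₂ (λ x z → x * 6 ^ z) (^-distribʳ-* 5 5 M) (m+[n∸m]≡n few) ⟩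
      5 ^ M * 5 ^ M * 6 ^ M
        ≡⟨ rearrange (5 ^ M) (6 ^ M) ⟩
      5 ^ M * (6 ^ M * 5 ^ M) ∎)
    where
    open ≤-Reasoning
    P = ∑ K degree
    k = M ∸ P
    F = ∏ n (λ u → weight (pop u true) + weight (pop u false))
    regroup : ∀ a b c d → a * (b * (c * d)) ≡ a * (b * c) * d
    regroup = solve-∀
    rearrange : ∀ a b → a * a * b ≡ a * (b * a)
    rearrange = solve-∀
    -- 4 + p ≤ 5 (6/5) ^ (p - 1) for p = 0, 1, 2
    local : ∀ b c → (weight b + weight c) * (6 * 5 ^ (⟦ b ⟧ + ⟦ c ⟧)) ≤ 25 * 6 ^ (⟦ b ⟧ + ⟦ c ⟧)
    local true true = ≤ᵇ⇒≤ 900 900 tt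
    local true false = ≤ᵇ⇒≤ 150 150 tt
    local false true = ≤ᵇ⇒≤ 150 150 tt
    local false false = ≤ᵇ⇒≤ 24 25 tt
    total : F * (6 ^ M * 5 ^ P) ≤ 25 ^ M * 6 ^ P
    total = subst₂ _≤_
      (trans (∏-* n _ _) (cong (F *_) (trans (∏-* n _ _) (cong₂ _*_ (∏-const n 6) (∏-^ n 5 degree)))))
      (trans (∏-* n _ _) (cong₂ _*_ (∏-const n 25) (∏-^ n 6 degree)))
      (∏-mono n (λ u → local (pop u true) (pop u false)))

  -- 3 ^ s * 2 ^ (M - s) is at least (27 * 4) ^ (M / 5) once s ≥ 3 M / 5
  deep-weight : ∀ h → 3 * M ≤ 5 * ∑ K (λ u → ⟦ pop u (at h u) ⟧) →
    108 ^ M ≤ ∏ n (λ u → weight (pop u (at h u))) ^ 5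
  deep-weight h le = begin
    108 ^ M
      ≡⟨ trans (^-distribʳ-* 27 4 M) (cong₂ _*_ (^-*-assoc 3 3 M) (^-*-assoc 2 2 M)) ⟩
    3 ^ (3 * M) * 2 ^ (2 * M)
      ≡⟨ cong (λ z → 3 ^ (3 * M) * 2 ^ z) 2M≡ ⟩
    3 ^ (3 * M) * 2 ^ (j + 5 * r)
      ≡⟨ cong (3 ^ (3 * M) *_) (^-distribˡ-+-* 2 j (5 * r)) ⟩
    3 ^ (3 * M) * (2 ^ j * 2 ^ (5 * r))
      ≤⟨ *-monoʳ-≤ (3 ^ (3 * M)) (*-monoˡ-≤ (2 ^ (5 * r)) (^-monoˡ-≤ j (≤ᵇ⇒≤ 2 3 tt))) ⟩
    3 ^ (3 * M) * (3 ^ j * 2 ^ (5 * r))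
      ≡⟨ trans (sym (*-assoc (3 ^ (3 * M)) (3 ^ j) _)) (cong (_* 2 ^ (5 * r))
           (trans (sym (^-distribˡ-+-* 3 (3 * M) j)) (cong (3 ^_) (m+[n∸m]≡n le)))) ⟩
    3 ^ (5 * s) * 2 ^ (5 * r)
      ≡⟨ cong₂ _*_ (fifth 3 s) (fifth 2 r) ⟩
    (3 ^ s) ^ 5 * (2 ^ r) ^ 5
      ≡⟨ sym (^-distribʳ-* (3 ^ s) (2 ^ r) 5) ⟩
    (3 ^ s * 2 ^ r) ^ 5
      ≡⟨ cong (_^ 5) (sym weight≡) ⟩
    ∏ n (λ u → weight (pop u (at h u))) ^ 5 ∎
    where
    open ≤-Reasoning
    s r j : ℕ
    s = ∑ K (λ u → ⟦ pop u (at h u) ⟧)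
    r = ∑ K (λ u → ⟦ not (pop u (at h u)) ⟧)
    j = 5 * s ∸ 3 * M
    s+r≡M : s + r ≡ M
    s+r≡M = trans (sym (∑-+ K _ _)) (trans (∑-cong K (λ u → one (pop u (at h u)))) (∑-1 K))
      where
      one : ∀ b → ⟦ b ⟧ + ⟦ not b ⟧ ≡ 1
      one true = refl
      one false = refl
    2M≡ : 2 * M ≡ j + 5 * r
    2M≡ = +-cancelˡ-≡ (3 * M) _ _ (trans (five M)
      (trans (cong (5 *_) (sym s+r≡M)) (trans (*-distribˡ-+ 5 s r)
      (trans (cong (_+ 5 * r) (sym (m+[n∸m]≡n le))) (+-assoc (3 * M) j (5 * r))))))
      where
      five : ∀ x → 3 * x + 2 * x ≡ 5 * x
      five = solve-∀
    fifth : ∀ c x → c ^ (5 * x) ≡ (c ^ x) ^ 5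
    fifth c x = trans (cong (c ^_) (*-comm 5 x)) (sym (^-*-assoc c x 5))
    weight≡ : ∏ n (λ u → weight (pop u (at h u))) ≡ 3 ^ s * 2 ^ r
    weight≡ = trans (≤-antisym (∏-mono n (λ u → ≤-reflexive (local (pop u (at h u)))))
                               (∏-mono n (λ u → ≤-reflexive (sym (local (pop u (at h u)))))))
      (trans (∏-* n _ _) (cong₂ _*_ (∏-^ n 3 _) (∏-^ n 2 _)))
      where
      local : ∀ b → weight b ≡ 3 ^ ⟦ b ⟧ * 2 ^ ⟦ not b ⟧
      local true = refl
      local false = refl

-- Markov's inequality raised to a power. As `b` need not have an integer root, the smallest weight
-- `c` on `τ` takes the place of that root.
∑-power : ∀ {A : Set} (l : List A) (τ : A → Bool) (w : A → ℕ) k b → (∀ x → τ x ≡ true → b ≤ w x ^ suc k) →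
  ∑ l (λ x → ⟦ τ x ⟧) ^ suc k * b ≤ ∑ l w ^ suc k
∑-power l τ w k b large with smallest l
  where
  smallest : ∀ l → ∑ l (λ x → ⟦ τ x ⟧) ≡ 0 ⊎ ∃ λ c → b ≤ c ^ suc k × ∑ l (λ x → ⟦ τ x ⟧) * c ≤ ∑ l w
  smallest [] = inj₁ refl
  smallest (x ∷ l) with τ x in e | smallest l
  ... | false | inj₁ z = inj₁ z
  ... | false | inj₂ (c , b≤ , le) = inj₂ (c , b≤ , ≤-trans le (m≤n+m _ (w x)))
  ... | true | inj₁ z = inj₂ (w x , large x e , ≤-trans (≤-reflexive
          (trans (cong (λ z → suc z * w x) z) (+-identityʳ (w x)))) (m≤m+n (w x) _))
  ... | true | inj₂ (c , b≤ , le) with ≤-total c (w x)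
  ...   | inj₁ c≤ = inj₂ (c , b≤ , +-mono-≤ c≤ le)
  ...   | inj₂ ≥w = inj₂ (w x , large x e ,
          +-monoʳ-≤ (w x) (≤-trans (*-monoʳ-≤ (∑ l (λ x → ⟦ τ x ⟧)) ≥w) le))
... | inj₁ z = subst (λ z → z ^ suc k * b ≤ ∑ l w ^ suc k) (sym z) z≤n
... | inj₂ (c , b≤ , le) = ≤-trans (*-monoʳ-≤ (N ^ suc k) b≤)
    (≤-trans (≤-reflexive (sym (^-distribʳ-* N c (suc k)))) (^-monoˡ-≤ (suc k) le))
  where N = ∑ l (λ x → ⟦ τ x ⟧)

-- Popular positions

size : ∀ {n} → (TruthTable n → Bool) → ℕ
size {n} τ = ∑ (tts n) (λ h → ⟦ τ h ⟧)

_≈_ : Bool → Bool → Bool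
b ≈ c = not (b xor c)

≈⇒≡ : ∀ {b c} → b ≈ c ≡ true → b ≡ c
≈⇒≡ {true} {true} _ = refl
≈⇒≡ {false} {false} _ = refl

module _ {n : ℕ} (τ : TruthTable n → Bool) (won : TruthTable n → Vec Bool n → Bool) where

  private
    H = tts n
    K = points n
    M = length K
    N = size τ

  extends : Vec Bool n → Bool → TruthTable n → Bool
  extends u β h = τ h ∧ (won h u ∧ at h u ≈ β)

  -- The threshold 1/60 leaves at most 2 M N / 60 = M N / 30 incidences between tables in `τ` and
  -- their unpopular winning points.
  popular : Vec Bool n → Bool → Bool
  popular u β = N ≤ᵇ 60 * size (extends u β)

  private
    unpopular : TruthTable n → ℕ
    unpopular h = ∑ K (λ u → ⟦ won h u ∧ not (popular u (at h u)) ⟧)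

    deep : TruthTable n → Bool
    deep h = 15 * unpopular h ≤ᵇ M

    unpopular-total : 60 * ∑ H (λ h → ⟦ τ h ⟧ * unpopular h) ≤ 2 * M * N
    unpopular-total = begin
      60 * ∑ H (λ h → ⟦ τ h ⟧ * unpopular h)
        ≤⟨ *-monoʳ-≤ 60 (∑-mono H (λ h → ≤-trans (≤-reflexive (sym (∑-*ˡ K ⟦ τ h ⟧ _)))
             (∑-mono K (λ u → local (τ h) (won h u) (popular u true) (popular u false) (popular u (at h u))
                                (at h u) (pop≡ u (at h u)))))) ⟩
      60 * ∑ H (λ h → ∑ K (λ u → missing h u true + missing h u false))
        ≡⟨ cong (60 *_) (∑-swap H K _) ⟩
      60 * ∑ K (λ u → ∑ H (λ h → missing h u true + missing h u false))
        ≡⟨ sym (∑-*ˡ K 60 _) ⟩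
      ∑ K (λ u → 60 * ∑ H (λ h → missing h u true + missing h u false))
        ≤⟨ ∑-mono K (λ u → ≤-trans (≤-reflexive (trans (cong (60 *_) (∑-+ H _ _))
             (*-distribˡ-+ 60 (∑ H (λ h → missing h u true)) _)))
             (+-mono-≤ (rare u true) (rare u false))) ⟩
      ∑ K (λ u → N + N)
        ≡⟨ trans (∑-const K (N + N)) (double M N) ⟩
      2 * M * N ∎
      where
      open ≤-Reasoning
      double : ∀ m n → m * (n + n) ≡ 2 * m * n
      double = solve-∀
      missing : TruthTable n → Vec Bool n → Bool → ℕ
      missing h u β = ⟦ extends u β h ⟧ * ⟦ not (popular u β) ⟧
      pop≡ : ∀ u b → popular u b ≡ (if b then popular u true else popular u false)
      pop≡ u true = refl
      pop≡ u false = refl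
      local : ∀ t w p q p' b → p' ≡ (if b then p else q) →
        ⟦ t ⟧ * ⟦ w ∧ not p' ⟧ ≤
        ⟦ t ∧ (w ∧ b ≈ true) ⟧ * ⟦ not p ⟧ + ⟦ t ∧ (w ∧ b ≈ false) ⟧ * ⟦ not q ⟧
      local false w p q p' b e = z≤n
      local true false p q p' b e = z≤n
      local true true p q .p true refl = m≤m+n (1 * ⟦ not p ⟧) _
      local true true p q .q false refl = ≤-refl
      rare : ∀ u β → 60 * ∑ H (λ h → missing h u β) ≤ N
      rare u β rewrite ∑-*ʳ H ⟦ not (popular u β) ⟧ (λ h → ⟦ extends u β h ⟧) with popular u β in e
      ... | true rewrite *-zeroʳ (size (extends u β)) = z≤n
      ... | false rewrite *-identityʳ (size (extends u β)) = <⇒≤ (≤ᵇ-false⁻ e)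

    -- By Markov, more than M / 15 unpopular winning points occur for at most half of the tables,
    -- since the average over `τ` is at most M / 30.
    mostly-deep : N ≤ 2 * size (λ h → τ h ∧ deep h)
    mostly-deep = +-cancelˡ-≤ N N _ (begin
      N + N
        ≡⟨ cong (λ x → x + x) (sym split) ⟩
      (d + s) + (d + s)
        ≡⟨ regroup d s ⟩
      2 * s + 2 * d
        ≤⟨ +-monoˡ-≤ (2 * d) shallow≤ ⟩
      N + 2 * d ∎)
      where
      open ≤-Reasoning
      d = size (λ h → τ h ∧ deep h)
      s = size (λ h → τ h ∧ not (deep h))
      regroup : ∀ d s → (d + s) + (d + s) ≡ 2 * s + 2 * d
      regroup = solve-∀
      split : d + s ≡ N
      split = trans (sym (∑-+ H _ _)) (∑-cong H (λ h → local (τ h) (deep h)))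
        where
        local : ∀ a b → ⟦ a ∧ b ⟧ + ⟦ a ∧ not b ⟧ ≡ ⟦ a ⟧
        local true true = refl
        local true false = refl
        local false b = refl
      markov : s * M ≤ 15 * ∑ H (λ h → ⟦ τ h ⟧ * unpopular h)
      markov = ≤-trans (≤-reflexive (sym (∑-*ʳ H M _)))
        (≤-trans (∑-mono H pointwise) (≤-reflexive (∑-*ˡ H 15 _)))
        where
        pointwise : ∀ h → ⟦ τ h ∧ not (deep h) ⟧ * M ≤ 15 * (⟦ τ h ⟧ * unpopular h)
        pointwise h with τ h | deep h in e
        ... | false | _ = z≤n
        ... | true | true = z≤n
        ... | true | false = ≤-trans (≤-reflexive (*-identityˡ M))
              (≤-trans (<⇒≤ (≤ᵇ-false⁻ e)) (*-monoʳ-≤ 15 (≤-reflexive (sym (*-identityˡ (unpopular h))))))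
      shallow≤ : 2 * s ≤ N
      shallow≤ = *-cancelʳ-≤ (2 * s) N (30 * M) {{m*n≢0 30 M {{_}} {{>-nonZero (points≢[] n)}}}} (begin
        2 * s * (30 * M)
          ≡⟨ e₁ s M ⟩
        60 * (s * M)
          ≤⟨ *-monoʳ-≤ 60 markov ⟩
        60 * (15 * ∑ H (λ h → ⟦ τ h ⟧ * unpopular h))
          ≡⟨ e₂ (∑ H (λ h → ⟦ τ h ⟧ * unpopular h)) ⟩
        15 * (60 * ∑ H (λ h → ⟦ τ h ⟧ * unpopular h))
          ≤⟨ *-monoʳ-≤ 15 unpopular-total ⟩
        15 * (2 * M * N)
          ≡⟨ e₃ M N ⟩
        N * (30 * M) ∎)
        where
        e₁ : ∀ s m → 2 * s * (30 * m) ≡ 60 * (s * m)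
        e₁ = solve-∀
        e₂ : ∀ x → 60 * (15 * x) ≡ 15 * (60 * x)
        e₂ = solve-∀
        e₃ : ∀ m n → 15 * (2 * m * n) ≡ n * (30 * m)
        e₃ = solve-∀

    -- Of the 2 M / 3 winning points at most M / 15 are unpopular, and 2/3 - 1/15 = 3/5.
    deep⇒score : (∀ h → τ h ≡ true → 2 * M ≤ 3 * ∑ K (λ u → ⟦ won h u ⟧)) →
      ∀ h → τ h ∧ deep h ≡ true → 3 * M ≤ 5 * ∑ K (λ u → ⟦ popular u (at h u) ⟧)
    deep⇒score wins₂ h p = *-cancelˡ-≤ 3 (+-cancelʳ-≤ M _ _ (begin
      3 * (3 * M) + M
        ≡⟨ e₁ M ⟩
      5 * (2 * M)
        ≤⟨ *-monoʳ-≤ 5 (wins₂ h (proj₁ (∧-true⁻ p))) ⟩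
      5 * (3 * ∑ K (λ u → ⟦ won h u ⟧))
        ≤⟨ *-monoʳ-≤ 5 (*-monoʳ-≤ 3 (≤-trans (∑-mono K (λ u → local (won h u) (popular u (at h u))))
             (≤-reflexive (∑-+ K _ _)))) ⟩
      5 * (3 * (s + unpopular h))
        ≡⟨ e₂ s (unpopular h) ⟩
      3 * (5 * s) + 15 * unpopular h
        ≤⟨ +-monoʳ-≤ (3 * (5 * s)) (≤ᵇ-true⁻ (proj₂ (∧-true⁻ p))) ⟩
      3 * (5 * s) + M ∎))
      where
      open ≤-Reasoning
      s = ∑ K (λ u → ⟦ popular u (at h u) ⟧)
      e₁ : ∀ m → 3 * (3 * m) + m ≡ 5 * (2 * m)
      e₁ = solve-∀
      e₂ : ∀ s v → 5 * (3 * (s + v)) ≡ 3 * (5 * s) + 15 * v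
      e₂ = solve-∀
      local : ∀ w p → ⟦ w ⟧ ≤ ⟦ p ⟧ + ⟦ w ∧ not p ⟧
      local false p = z≤n
      local true true = ≤-refl
      local true false = ≤-refl

  -- With at most M popular positions the weights would sum to at most 5 ^ M, while at least N / 2
  -- deep tables weigh at least 108 ^ (M / 5) each. Fifth powers give 32 = 2 ^ 5 and 3125 = 5 ^ 5.
  many-popular : (∀ h → τ h ≡ true → 2 * M ≤ 3 * ∑ K (λ u → ⟦ won h u ⟧)) →
    32 * 3125 ^ M < N ^ 5 * 108 ^ M → M < ∑ K (λ u → ⟦ popular u true ⟧ + ⟦ popular u false ⟧)
  many-popular wins₂ big = ≰⇒> λ few → <⇒≱ big (begin
    N ^ 5 * 108 ^ M
      ≤⟨ *-monoˡ-≤ (108 ^ M) (^-monoˡ-≤ 5 mostly-deep) ⟩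
    (2 * d) ^ 5 * 108 ^ M
      ≡⟨ trans (cong (_* 108 ^ M) (^-distribʳ-* 2 d 5)) (*-assoc 32 (d ^ 5) (108 ^ M)) ⟩
    32 * (d ^ 5 * 108 ^ M)
      ≤⟨ *-monoʳ-≤ 32 (≤-trans
           (∑-power H (λ h → τ h ∧ deep h) (λ h → ∏ n (λ u → weight popular (popular u (at h u)))) 4 (108 ^ M)
              (λ h p → deep-weight popular h (deep⇒score wins₂ h p)))
           (^-monoˡ-≤ 5 (∑-weights popular few))) ⟩
    32 * (5 ^ M) ^ 5
      ≡⟨ cong (32 *_) (trans (^-*-assoc 5 M 5) (trans (cong (5 ^_) (*-comm M 5)) (sym (^-*-assoc 5 5 M)))) ⟩
    32 * 3125 ^ M ∎)
    where
    open ≤-Reasoning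
    d = size (λ h → τ h ∧ deep h)

-- Two sets of more than M popular positions meet even after flipping the values of one of them.
common-popular : ∀ {n} (p q : Vec Bool n → Bool → Bool) →
  length (points n) < ∑ (points n) (λ u → ⟦ p u true ⟧ + ⟦ p u false ⟧) →
  length (points n) < ∑ (points n) (λ u → ⟦ q u true ⟧ + ⟦ q u false ⟧) →
  ∃₂ λ u β → p u β ≡ true × q u (not β) ≡ true
common-popular {n} p q hp hq
  with ∑-exists-< K (λ _ → 2) (λ u → (⟦ p u true ⟧ + ⟦ p u false ⟧) + (⟦ q u true ⟧ + ⟦ q u false ⟧))
         (≤-trans (s≤s (≤-reflexive (trans (∑-const K 2) (trans (*-comm (length K) 2) (two (length K))))))
           (≤-trans (+-mono-≤ hp (<⇒≤ hq)) (≤-reflexive (sym (∑-+ K _ _)))))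
  where
  K = points n
  two : ∀ m → 2 * m ≡ m + m
  two = solve-∀
... | u , lt with p u true in e₁ | p u false in e₂ | q u true in e₃ | q u false in e₄
...   | true | _ | _ | true = u , true , e₁ , e₄
...   | _ | true | true | _ = u , false , e₂ , e₃
...   | true | false | true | false = ⊥-elim (<-irrefl refl lt)
...   | false | true | false | true = ⊥-elim (<-irrefl refl lt)
...   | true | true | false | false = ⊥-elim (<-irrefl refl lt)
...   | false | false | true | true = ⊥-elim (<-irrefl refl lt)
...   | true | false | false | false = ⊥-elim (<⇒≱ lt (s≤s z≤n))
...   | false | true | false | false = ⊥-elim (<⇒≱ lt (s≤s z≤n))
...   | false | false | true | false = ⊥-elim (<⇒≱ lt (s≤s z≤n))
...   | false | false | false | true = ⊥-elim (<⇒≱ lt (s≤s z≤n))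
...   | false | false | false | false = ⊥-elim (<⇒≱ lt z≤n)

cancel-fifth : ∀ q r p x y t s .{{_ : NonZero q}} →
  r * (q * p) ^ 5 * x < t ^ 5 * y → t ≤ q * s → r * p ^ 5 * x < s ^ 5 * y
cancel-fifth q r p x y t s lt le = *-cancelˡ-< (q ^ 5) _ _ (begin-strict
  q ^ 5 * (r * p ^ 5 * x)
    ≡⟨ rearrange (q ^ 5) r (p ^ 5) x ⟩
  r * (q ^ 5 * p ^ 5) * x
    ≡⟨ cong (λ z → r * z * x) (sym (^-distribʳ-* q p 5)) ⟩
  r * (q * p) ^ 5 * x
    <⟨ lt ⟩
  t ^ 5 * y
    ≤⟨ *-monoˡ-≤ y (^-monoˡ-≤ 5 le) ⟩
  (q * s) ^ 5 * y
    ≡⟨ trans (cong (_* y) (^-distribʳ-* q s 5)) (*-assoc (q ^ 5) (s ^ 5) y) ⟩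
  q ^ 5 * (s ^ 5 * y) ∎)
  where
  open ≤-Reasoning
  rearrange : ∀ a b c d → a * (b * c * d) ≡ b * (a * c) * d
  rearrange = solve-∀

-- Each of the k remaining coordinates of the walk may cost a factor 60.
record Rich {n : ℕ} (τ : TruthTable n → Bool) (k : ℕ) : Set where
  constructor rich
  field
    many : 32 * (60 ^ k) ^ 5 * 3125 ^ length (points n) < size τ ^ 5 * 108 ^ length (points n)

module _ {n : ℕ} where

  private
    M = length (points n)

  Rich-zero : ∀ (τ : TruthTable n → Bool) k → Rich τ k → 32 * 3125 ^ M < size τ ^ 5 * 108 ^ M
  Rich-zero τ k (rich lt) = ≤-<-trans (*-monoˡ-≤ (3125 ^ M)
    (*-monoʳ-≤ 32 {1} {(60 ^ k) ^ 5} (m^n>0 (60 ^ k) {{m^n≢0 60 k}} 5))) lt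

  Rich-weaken : ∀ (τ : TruthTable n → Bool) k → Rich τ (suc k) → Rich τ k
  Rich-weaken τ k (rich lt) = rich (≤-<-trans (*-monoˡ-≤ (3125 ^ M) (*-monoʳ-≤ 32
    (^-monoˡ-≤ 5 (m≤m+n (60 ^ k) _)))) lt)

  Rich-step : ∀ (τ σ : TruthTable n → Bool) k → Rich τ (suc k) → size τ ≤ 60 * size σ → Rich σ k
  Rich-step τ σ k (rich lt) le =
    rich (cancel-fifth 60 32 (60 ^ k) (3125 ^ M) (108 ^ M) (size τ) (size σ) lt le)

  Rich⇒element : ∀ (τ : TruthTable n → Bool) k → Rich τ k → ∃ λ h → τ h ≡ true
  Rich⇒element τ k (rich lt) with search τ (tts n)
  ... | inj₁ r = r
  ... | inj₂ none = ⊥-elim (<⇒≱ lt (subst (λ z → z ^ 5 * 108 ^ M ≤ _) (sym empty) z≤n))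
    where
    zero-sum : (l : List (TruthTable n)) → (∀ {h} → h ∈ l → τ h ≡ false) → ∑ l (λ h → ⟦ τ h ⟧) ≡ 0
    zero-sum [] e = refl
    zero-sum (h ∷ l) e rewrite e (here refl) = zero-sum l (λ p → e (there p))
    empty : size τ ≡ 0
    empty = zero-sum (tts n) none

  common-extension : ∀ k (τ σ : TruthTable n → Bool) (v w : TruthTable n → Vec Bool n → Bool) →
    (∀ h → τ h ≡ true → 2 * M ≤ 3 * ∑ (points n) (λ u → ⟦ v h u ⟧)) →
    (∀ h → σ h ≡ true → 2 * M ≤ 3 * ∑ (points n) (λ u → ⟦ w h u ⟧)) →
    Rich τ (suc k) → Rich σ (suc k) →
    ∃₂ λ u β → Rich (extends τ v u β) k × Rich (extends σ w u (not β)) k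
  common-extension k τ σ v w vτ wσ rτ rσ =
    let u , β , pτ , pσ = common-popular {n} (popular {n} τ v) (popular {n} σ w)
          (many-popular {n} τ v vτ (Rich-zero τ (suc k) rτ)) (many-popular {n} σ w wσ (Rich-zero σ (suc k) rσ))
    in u , β ,
       Rich-step τ (extends τ v u β) k rτ (≤ᵇ-true⁻ {size τ} {60 * size (extends τ v u β)} pτ) ,
       Rich-step σ (extends σ w u (not β)) k rσ (≤ᵇ-true⁻ {size σ} {60 * size (extends σ w u (not β))} pσ)

  extends-row : ∀ {m} (τ : TruthTable n → Bool) (a D : Vec Bool m) c (s : Rows (suc m) (suc n) → Bool) u β h →
    extends τ (λ h u → wins h a D (λ X → s (row h c u ∷ X))) u β h ≡ true →
    wins h a D (λ X → s (((β xor c) ∷ u) ∷ X)) ≡ true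
  extends-row τ a D c s u β h p =
    let w , eq = ∧-true⁻ (proj₂ (∧-true⁻ {τ h} p)) in
    subst (λ b → wins h a D (λ X → s (((b xor c) ∷ u) ∷ X)) ≡ true) (≈⇒≡ {at h u} {β} eq) w

  -- Both players walk to the same masked matrix, on which s would have to be true and false.
  -- Where a and b differ, the two truth tables are chosen with opposite values at the common point.
  no-rich-pair : ∀ {m} (a b : Vec Bool m) (s : Rows m (suc n) → Bool) (τ σ : TruthTable n → Bool) →
    (∀ h → τ h ≡ true → wins h a (a ⊕ b) s ≡ true) →
    (∀ h → σ h ≡ true → wins h b (a ⊕ b) (not ∘ s) ≡ true) →
    Rich τ m → Rich σ m → ⊥
  no-rich-pair [] [] s τ σ wτ wσ rτ rσ =
    let h , τh = Rich⇒element τ 0 rτ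
        h' , σh' = Rich⇒element σ 0 rσ
    in true≢false (wτ h τh) (not-true⁻ (wσ h' σh'))
  no-rich-pair {suc m} (true ∷ a) (true ∷ b) s τ σ wτ wσ rτ rσ =
    no-rich-pair a b (λ X → s (blank ∷ X)) τ σ wτ wσ (Rich-weaken τ m rτ) (Rich-weaken σ m rσ)
  no-rich-pair {suc m} (false ∷ a) (false ∷ b) s τ σ wτ wσ rτ rσ =
    no-rich-pair a b (λ X → s (blank ∷ X)) τ σ wτ wσ (Rich-weaken τ m rτ) (Rich-weaken σ m rσ)
  no-rich-pair {suc m} (true ∷ a) (false ∷ b) s τ σ wτ wσ rτ rσ =
    let v = λ h u → wins h a (a ⊕ b) (λ X → s (row h true u ∷ X))
        w = λ h u → wins h b (a ⊕ b) (λ X → not (s (row h false u ∷ X)))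
        u , β , rτ' , rσ' = common-extension m τ σ v w
          (λ h e → ≤ᵇ-true⁻ {2 * M} (wτ h e)) (λ h e → ≤ᵇ-true⁻ {2 * M} (wσ h e)) rτ rσ
    in no-rich-pair a b (λ X → s (((β xor true) ∷ u) ∷ X)) (extends τ v u β) (extends σ w u (not β))
      (extends-row τ a (a ⊕ b) true s u β)
      -- Opposite table values and opposite target bits give the same first bit, so both walks
      -- continue with the same row.
      (λ h p → subst (λ c → wins h b (a ⊕ b) (λ X → not (s ((c ∷ u) ∷ X))) ≡ true) (flip β)
        (extends-row σ b (a ⊕ b) false (not ∘ s) u (not β) h p))
      rτ' rσ'
    where
    flip : ∀ β → not β xor false ≡ β xor true
    flip true = refl
    flip false = refl
  no-rich-pair {suc m} (false ∷ a) (true ∷ b) s τ σ wτ wσ rτ rσ =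
    let v = λ h u → wins h a (a ⊕ b) (λ X → s (row h false u ∷ X))
        w = λ h u → wins h b (a ⊕ b) (λ X → not (s (row h true u ∷ X)))
        u , β , rτ' , rσ' = common-extension m τ σ v w
          (λ h e → ≤ᵇ-true⁻ {2 * M} (wτ h e)) (λ h e → ≤ᵇ-true⁻ {2 * M} (wσ h e)) rτ rσ
    in no-rich-pair a b (λ X → s (((β xor false) ∷ u) ∷ X)) (extends τ v u β) (extends σ w u (not β))
      (extends-row τ a (a ⊕ b) false s u β)
      (λ h p → subst (λ c → wins h b (a ⊕ b) (λ X → not (s ((c ∷ u) ∷ X))) ≡ true) (flip β)
        (extends-row σ b (a ⊕ b) true (not ∘ s) u (not β) h p))
      rτ' rσ'
    where
    flip : ∀ β → not β xor true ≡ β xor false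
    flip true = refl
    flip false = refl

-- Counting codes

literal : ∀ {m n} → Bool → Fin m × Fin n → Formula m n 0
literal b (i , j) = lit b i j

indices : ∀ m n → List (Fin m × Fin n)
indices m n = cartesianProductWith _,_ (allFin m) (allFin n)

literals : ∀ m n → List (Formula m n 0)
literals m n = cartesianProductWith literal bools (indices m n)

formulas : ∀ m n e → List (Formula m n e)
formulas m n zero = const true ∷ const false ∷ literals m n
formulas m n (suc e) = cartesianProductWith and (formulas m n e) (formulas m n e) ++
                       cartesianProductWith or (formulas m n e) (formulas m n e)

∈-formulas : ∀ {m n e} (s : Formula m n e) → s ∈ formulas m n e
∈-formulas (const true) = here refl
∈-formulas (const false) = there (here refl)
∈-formulas (lit b i j) = there (there (∈-cartesianProductWith⁺ literal (∈-bools b)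
  (∈-cartesianProductWith⁺ _,_ (∈-allFin i) (∈-allFin j))))
∈-formulas (and s t) = ∈-++⁺ˡ (∈-cartesianProductWith⁺ and (∈-formulas s) (∈-formulas t))
∈-formulas (or s t) = ∈-++⁺ʳ _ (∈-cartesianProductWith⁺ or (∈-formulas s) (∈-formulas t))

-- From F formulas of one depth come 2 F ^ 2 of the next, so twice the number gets squared.
length-formulas : ∀ m n e → 2 * length (formulas m n e) ≡ (2 * (2 + 2 * (m * n))) ^ (2 ^ e)
length-formulas m n zero = trans (cong (λ l → 2 * (2 + l)) length-literals) (sym (^-identityʳ _))
  where
  length-literals : length (literals m n) ≡ 2 * (m * n)
  length-literals = trans (length-product literal bools (indices m n)) (cong (2 *_)
    (trans (length-product _,_ (allFin m) (allFin n))
           (cong₂ _*_ (length-tabulate {n = m} (λ i → i)) (length-tabulate {n = n} (λ i → i)))))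
length-formulas m n (suc e) = begin
  2 * length (formulas m n (suc e))
    ≡⟨ cong (2 *_) (trans (length-++ (cartesianProductWith and F F))
         (cong₂ _+_ (length-product and F F) (length-product or F F))) ⟩
  2 * (length F * length F + length F * length F)
    ≡⟨ square (length F) ⟩
  (2 * length F) * (2 * length F)
    ≡⟨ cong₂ _*_ (length-formulas m n e) (length-formulas m n e) ⟩
  b ^ (2 ^ e) * b ^ (2 ^ e)
    ≡⟨ sym (^-distribˡ-+-* b (2 ^ e) (2 ^ e)) ⟩
  b ^ (2 ^ e + 2 ^ e)
    ≡⟨ cong (λ z → b ^ (2 ^ e + z)) (sym (+-identityʳ (2 ^ e))) ⟩
  b ^ (2 ^ suc e) ∎
  where
  open ≡-Reasoning
  F = formulas m n e
  b = 2 * (2 + 2 * (m * n))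
  square : ∀ l → 2 * (l * l + l * l) ≡ (2 * l) * (2 * l)
  square = solve-∀

codes : ∀ m n e → List (Code m n e)
codes m n e = cartesianProductWith _,_ (vecs bools m)
  (cartesianProductWith _,_ (vecs bools m) (formulas m (suc n) e))

∈-codes : ∀ {m n e} (c : Code m n e) → c ∈ codes m n e
∈-codes (a , b , s) = ∈-cartesianProductWith⁺ _,_ (∈-vecs bools ∈-bools a)
  (∈-cartesianProductWith⁺ _,_ (∈-vecs bools ∈-bools b) (∈-formulas s))

length-codes : ∀ m n e → length (codes m n e) ≡ 2 ^ m * (2 ^ m * length (formulas m (suc n) e))
length-codes m n e = trans (length-product _,_ (vecs bools m) _)
  (cong₂ _*_ (length-vecs bools m) (trans (length-product _,_ (vecs bools m) (formulas m (suc n) e))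
    (cong (_* length (formulas m (suc n) e)) (length-vecs bools m))))

-- Used with a = 3125 and b = 3456 = 32 * 108: the factor 2 ^ k pays for the union bound over codes.
gap : ∀ a b k M → 2 * a ^ 7 ≤ b ^ 7 → a ≤ b → 7 * k ≤ M → 2 ^ k * a ^ M ≤ b ^ M
gap a b k M base a≤b 7k≤M = begin
  2 ^ k * a ^ M
    ≡⟨ cong (λ z → 2 ^ k * a ^ z) (sym (m+[n∸m]≡n 7k≤M)) ⟩
  2 ^ k * a ^ (7 * k + r)
    ≡⟨ trans (cong (2 ^ k *_) (^-distribˡ-+-* a (7 * k) r)) (sym (*-assoc (2 ^ k) (a ^ (7 * k)) (a ^ r))) ⟩
  2 ^ k * a ^ (7 * k) * a ^ r
    ≡⟨ cong (_* a ^ r) (trans (cong (2 ^ k *_) (sym (^-*-assoc a 7 k))) (sym (^-distribʳ-* 2 (a ^ 7) k))) ⟩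
  (2 * a ^ 7) ^ k * a ^ r
    ≤⟨ *-mono-≤ (^-monoˡ-≤ k base) (^-monoˡ-≤ r a≤b) ⟩
  (b ^ 7) ^ k * b ^ r
    ≡⟨ trans (cong (_* b ^ r) (^-*-assoc b 7 k)) (sym (^-distribˡ-+-* b (7 * k) r)) ⟩
  b ^ (7 * k + r)
    ≡⟨ cong (b ^_) (m+[n∸m]≡n 7k≤M) ⟩
  b ^ M ∎
  where
  open ≤-Reasoning
  r = M ∸ 7 * k

-- The crude estimate 2 (2 + Z) ≤ 2 ^ (Z + 1) suffices: a factor polynomial in m n in the exponent
-- lowers the admissible `e` only by O(log(m n)).
length-codes≤ : ∀ m n e → 1 ≤ m → let Z = 2 * m * suc n in
  length (codes m n e) ≤ 2 ^ (2 * m + (Z + 1) * 2 ^ e)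
length-codes≤ m n e m≥1 = begin
  length (codes m n e)
    ≡⟨ length-codes m n e ⟩
  2 ^ m * (2 ^ m * length (formulas m (suc n) e))
    ≤⟨ *-monoʳ-≤ (2 ^ m) (*-monoʳ-≤ (2 ^ m) formulas≤) ⟩
  2 ^ m * (2 ^ m * 2 ^ ((Z + 1) * 2 ^ e))
    ≡⟨ trans (cong (2 ^ m *_) (sym (^-distribˡ-+-* 2 m _))) (sym (^-distribˡ-+-* 2 m _)) ⟩
  2 ^ (m + (m + (Z + 1) * 2 ^ e))
    ≡⟨ cong (2 ^_) (regroup m ((Z + 1) * 2 ^ e)) ⟩
  2 ^ (2 * m + (Z + 1) * 2 ^ e) ∎
  where
  open ≤-Reasoning
  Z = 2 * m * suc n
  regroup : ∀ m x → m + (m + x) ≡ 2 * m + x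
  regroup = solve-∀
  exponential : ∀ k → 2 * (2 + (2 + k)) ≤ 2 ^ (2 + k + 1)
  exponential zero = ≤-refl
  exponential (suc k) = ≤-trans (≤-trans (m≤m+n _ _) (≤-reflexive (step k))) (*-monoʳ-≤ 2 (exponential k))
    where
    step : ∀ k → 2 * (2 + (2 + suc k)) + (6 + 2 * k) ≡ 2 * (2 * (2 + (2 + k)))
    step = solve-∀
  Z≥2 : 2 ≤ Z
  Z≥2 = *-mono-≤ (*-monoʳ-≤ 2 m≥1) (s≤s z≤n)
  formulas≤ : length (formulas m (suc n) e) ≤ 2 ^ ((Z + 1) * 2 ^ e)
  formulas≤ = begin
    length (formulas m (suc n) e)
      ≤⟨ m≤m+n _ _ ⟩
    2 * length (formulas m (suc n) e)
      ≡⟨ trans (length-formulas m (suc n) e)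
           (cong (λ z → (2 * (2 + z)) ^ (2 ^ e)) (sym (*-assoc 2 m (suc n)))) ⟩
    (2 * (2 + Z)) ^ (2 ^ e)
      ≤⟨ ^-monoˡ-≤ (2 ^ e) (subst (λ z → 2 * (2 + z) ≤ 2 ^ (z + 1)) (m+[n∸m]≡n Z≥2) (exponential (Z ∸ 2))) ⟩
    (2 ^ (Z + 1)) ^ (2 ^ e)
      ≡⟨ ^-*-assoc 2 (Z + 1) (2 ^ e) ⟩
    2 ^ ((Z + 1) * 2 ^ e) ∎

-- The fifth power of the union bound: 3456 ^ M is 2 ^ (5 M) * 108 ^ M, and the gap between 3125 and
-- 3456 pays for the codes and for the losses of the walk.
few-codes : ∀ m n e M → 1 ≤ m → 512 * (2 * m * suc n) * 2 ^ e ≤ M →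
  length (codes m n e) ^ 5 * (32 * (60 ^ m) ^ 5 * 3125 ^ M) < 3456 ^ M
few-codes m n e M m≥1 large = begin-strict
  length (codes m n e) ^ 5 * (32 * (60 ^ m) ^ 5 * 3125 ^ M)
    ≤⟨ *-mono-≤ (^-monoˡ-≤ 5 (length-codes≤ m n e m≥1))
         (*-monoˡ-≤ (3125 ^ M) (*-monoʳ-≤ 32 (^-monoˡ-≤ 5 (^-monoˡ-≤ m (≤ᵇ⇒≤ 60 64 tt))))) ⟩
  (2 ^ c) ^ 5 * (32 * (64 ^ m) ^ 5 * 3125 ^ M)
    ≡⟨ cong₂ (λ x y → x * (32 * y * 3125 ^ M)) (^-*-assoc 2 c 5)
         (trans (cong (_^ 5) (^-*-assoc 2 6 m)) (^-*-assoc 2 (6 * m) 5)) ⟩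
  2 ^ (c * 5) * (2 ^ 5 * 2 ^ (6 * m * 5) * 3125 ^ M)
    ≡⟨ powers (c * 5) 5 (6 * m * 5) (3125 ^ M) ⟩
  2 ^ (c * 5 + 5 + 6 * m * 5) * 3125 ^ M
    -- The exponent is at most 35 y; 73 y is the largest multiple that `gap` admits, as 7 * 73 = 511
    -- ≤ 512.
    <⟨ *-monoˡ-< (3125 ^ M) {{m^n≢0 3125 M}} (^-monoʳ-< 2 ≤-refl exponent) ⟩
  2 ^ (73 * (Z * 2 ^ e)) * 3125 ^ M
    ≤⟨ gap 3125 3456 (73 * (Z * 2 ^ e)) M (≤ᵇ⇒≤ (2 * 3125 ^ 7) (3456 ^ 7) tt) (≤ᵇ⇒≤ 3125 3456 tt) 511≤ ⟩
  3456 ^ M ∎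
  where
  open ≤-Reasoning
  Z = 2 * m * suc n
  c = 2 * m + (Z + 1) * 2 ^ e
  y = Z * 2 ^ e
  powers : ∀ i j k x → 2 ^ i * (2 ^ j * 2 ^ k * x) ≡ 2 ^ (i + j + k) * x
  powers i j k x = trans (regroup (2 ^ i) (2 ^ j) (2 ^ k) x) (cong (_* x)
    (sym (trans (^-distribˡ-+-* 2 (i + j) k) (cong (_* 2 ^ k) (^-distribˡ-+-* 2 i j)))))
    where
    regroup : ∀ a b c x → a * (b * c * x) ≡ a * b * c * x
    regroup = solve-∀
  Z≥2m : 2 * m ≤ Z
  Z≥2m = m≤m*n (2 * m) (suc n)
  y≥2m : 2 * m ≤ y
  y≥2m = ≤-trans Z≥2m (m≤m*n Z (2 ^ e) {{m^n≢0 2 e}})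
  y≥1 : 1 ≤ y
  y≥1 = ≤-trans (≤-trans m≥1 (m≤m+n m _)) y≥2m
  y≥E : 2 ^ e ≤ y
  y≥E = m≤n*m (2 ^ e) Z {{>-nonZero (≤-trans (≤-trans m≥1 (m≤m+n m _)) Z≥2m)}}
  exponent : c * 5 + 5 + 6 * m * 5 < 73 * y
  exponent = begin-strict
    c * 5 + 5 + 6 * m * 5
      ≡⟨ e₁ m Z (2 ^ e) ⟩
    20 * (2 * m) + 5 * y + 5 * 2 ^ e + 5
      ≤⟨ +-mono-≤ (+-mono-≤ (+-monoˡ-≤ (5 * y) (*-monoʳ-≤ 20 y≥2m)) (*-monoʳ-≤ 5 y≥E)) (*-monoʳ-≤ 5 y≥1) ⟩
    20 * y + 5 * y + 5 * y + 5 * y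
      ≡⟨ e₂ y ⟩
    35 * y
      <⟨ *-monoˡ-< y {{>-nonZero y≥1}} (≤ᵇ⇒≤ 36 73 tt) ⟩
    73 * y ∎
    where
    e₁ : ∀ m z x → (2 * m + (z + 1) * x) * 5 + 5 + 6 * m * 5 ≡ 20 * (2 * m) + 5 * (z * x) + 5 * x + 5
    e₁ = solve-∀
    e₂ : ∀ y → 20 * y + 5 * y + 5 * y + 5 * y ≡ 35 * y
    e₂ = solve-∀
  511≤ : 7 * (73 * y) ≤ M
  511≤ = begin
    7 * (73 * y)    ≡⟨ sym (*-assoc 7 73 y) ⟩
    511 * y         ≤⟨ *-monoˡ-≤ y (≤ᵇ⇒≤ 511 512 tt) ⟩
    512 * y         ≡⟨ sym (*-assoc 512 Z (2 ^ e)) ⟩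
    512 * Z * 2 ^ e ≤⟨ large ⟩
    M               ∎

^-cancelˡ-< : ∀ {a b} n → a ^ n < b ^ n → a < b
^-cancelˡ-< n lt = ≰⇒> λ b≤a → <⇒≱ lt (^-monoˡ-≤ n b≤a)

-- Union bound. The tables that make one code good cannot be rich: used both as Alice's and as Bob's
-- family they would contradict `no-rich-pair`. So each code is good for fewer than 2 ^ M / C
-- tables, where C counts the codes.
exists-avoiding : ∀ {m n e} → 1 ≤ m → 512 * (2 * m * suc n) * 2 ^ e ≤ 2 ^ n →
  ∃ λ (h : TruthTable n) → ∀ (c : Code m n e) → good h c ≡ false
exists-avoiding {m} {n} {e} m≥1 large
  with ∑-exists-< (tts n) (λ h → ∑ Cs (λ c → ⟦ good h c ⟧)) (λ _ → 1) total
  where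
  open ≤-Reasoning
  Cs = codes m n e
  C = length Cs
  M = 2 ^ n
  hits : Code m n e → ℕ
  hits c = size (λ h → good h c)
  C≥1 : 1 ≤ C
  C≥1 = ≤-trans (s≤s z≤n) (≤-trans (⟦∈⟧ (∈-codes (replicate m true , replicate m true , always e))) (≤-reflexive (∑-1 Cs)))
    where
    always : ∀ e → Formula m (suc n) e
    always zero = const true
    always (suc e) = and (always e) (always e)
    ⟦∈⟧ : ∀ {c} → c ∈ Cs → 1 ≤ ∑ Cs (λ _ → 1)
    ⟦∈⟧ p = ∈⇒≤∑ (λ _ → 1) p
  hits-small : ∀ c → C * hits c < 2 ^ M
  hits-small c@(a , b , s) = ^-cancelˡ-< 5 (*-cancelʳ-< (108 ^ M) _ _ (begin-strict
    (C * hits c) ^ 5 * 108 ^ M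
      ≡⟨ trans (cong (_* 108 ^ M) (^-distribʳ-* C (hits c) 5)) (*-assoc (C ^ 5) (hits c ^ 5) (108 ^ M)) ⟩
    C ^ 5 * (hits c ^ 5 * 108 ^ M)
      ≤⟨ *-monoʳ-≤ (C ^ 5) not-rich ⟩
    C ^ 5 * (32 * (60 ^ m) ^ 5 * 3125 ^ M)
      <⟨ few-codes m n e M m≥1 large ⟩
    3456 ^ M
      ≡⟨ trans (^-distribʳ-* 32 108 M) (cong (_* 108 ^ M)
           (trans (^-*-assoc 2 5 M) (trans (cong (2 ^_) (*-comm 5 M)) (sym (^-*-assoc 2 M 5))))) ⟩
    (2 ^ M) ^ 5 * 108 ^ M ∎))
    where
    not-rich : hits c ^ 5 * 108 ^ M ≤ 32 * (60 ^ m) ^ 5 * 3125 ^ M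
    not-rich = ≮⇒≥ λ lt →
      let rich' = rich (subst (λ z → 32 * (60 ^ m) ^ 5 * 3125 ^ z < hits c ^ 5 * 108 ^ z) (sym (length-points n)) lt)
      in no-rich-pair a b (eval s) (λ h → good h c) (λ h → good h c)
           (λ h g → proj₁ (∧-true⁻ g)) (λ h g → proj₂ (∧-true⁻ g)) rich' rich'
  total : ∑ (tts n) (λ h → ∑ Cs (λ c → ⟦ good h c ⟧)) < ∑ (tts n) (λ _ → 1)
  total = subst₂ _<_ (sym (∑-swap (tts n) Cs _)) (sym (trans (∑-1 (tts n)) (length-tts n)))
    (*-cancelˡ-≤ C {{>-nonZero C≥1}} (begin
      C * suc (∑ Cs hits)
        ≡⟨ *-suc C (∑ Cs hits) ⟩
      C + C * ∑ Cs hits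
        ≡⟨ cong₂ _+_ (sym (∑-1 Cs)) (sym (∑-*ˡ Cs C hits)) ⟩
      ∑ Cs (λ _ → 1) + ∑ Cs (λ c → C * hits c)
        ≡⟨ sym (∑-+ Cs _ _) ⟩
      ∑ Cs (λ c → suc (C * hits c))
        ≤⟨ ∑-mono Cs hits-small ⟩
      ∑ Cs (λ _ → 2 ^ M)
        ≡⟨ ∑-const Cs (2 ^ M) ⟩
      C * 2 ^ M ∎))
... | h , none = h , λ c → zero-⟦⟧ (≤-<-trans (∈⇒≤∑ (λ c → ⟦ good h c ⟧) (∈-codes c)) none)
  where
  zero-⟦⟧ : ∀ {b} → ⟦ b ⟧ < 1 → b ≡ false
  zero-⟦⟧ {false} _ = refl
  zero-⟦⟧ {true} (s≤s ())

-- The bound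

mapProtocol : {A B O A' B' O' : Set} → (A' → A) → (B' → B) → (O → O') → Protocol A B O → Protocol A' B' O'
mapProtocol α β ω (leaf o) = leaf (ω o)
mapProtocol α β ω (alice q l r) = alice (q ∘ α) (mapProtocol α β ω l) (mapProtocol α β ω r)
mapProtocol α β ω (bob q l r) = bob (q ∘ β) (mapProtocol α β ω l) (mapProtocol α β ω r)

module _ {A B O A' B' O' : Set} (α : A' → A) (β : B' → B) (ω : O → O') where

  run-mapProtocol : ∀ P x y → run (mapProtocol α β ω P) x y ≡ ω (run P (α x) (β y))
  run-mapProtocol (leaf o) x y = refl
  run-mapProtocol (alice q l r) x y with q (α x)
  ... | false = run-mapProtocol l x y
  ... | true = run-mapProtocol r x y
  run-mapProtocol (bob q l r) x y with q (β y)
  ... | false = run-mapProtocol l x y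
  ... | true = run-mapProtocol r x y

  leaves-mapProtocol : ∀ P → leaves (mapProtocol α β ω P) ≡ leaves P
  leaves-mapProtocol (leaf o) = refl
  leaves-mapProtocol (alice q l r) = cong₂ _+_ (leaves-mapProtocol l) (leaves-mapProtocol r)
  leaves-mapProtocol (bob q l r) = cong₂ _+_ (leaves-mapProtocol l) (leaves-mapProtocol r)

leaves≤ : {A B O : Set} (P : Protocol A B O) → leaves P ≤ 2 ^ depth P
leaves≤ (leaf o) = ≤-refl
leaves≤ (alice q l r) = +-mono-≤ (≤-trans (leaves≤ l) (^-monoʳ-≤ 2 (m≤m⊔n (depth l) (depth r))))
  (≤-trans (≤-trans (leaves≤ r) (^-monoʳ-≤ 2 (m≤n⊔m (depth l) (depth r)))) (m≤m+n _ 0))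
leaves≤ (bob q l r) = +-mono-≤ (≤-trans (leaves≤ l) (^-monoʳ-≤ 2 (m≤m⊔n (depth l) (depth r))))
  (≤-trans (≤-trans (leaves≤ r) (^-monoʳ-≤ 2 (m≤n⊔m (depth l) (depth r)))) (m≤m+n _ 0))

-- Functions on BVec m need not respect pointwise equality; a solvable f does.
module _ {m : ℕ} (f : BVec m → Bool) (P : KWProtocol m) (P-solves : Solves P (KW f)) where

  true-resp : ∀ {x y} → (∀ i → x i ≡ y i) → f x ≡ true → f y ≡ true
  true-resp {x} {y} e fx with f y in fy
  ... | true = refl
  ... | false = ⊥-elim (P-solves x y fx fy (e _))

  false-resp : ∀ {x y} → (∀ i → x i ≡ y i) → f x ≡ false → f y ≡ false
  false-resp {x} {y} e fx with f y in fy
  ... | false = refl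
  ... | true = ⊥-elim (P-solves y x fy fx (sym (e _)))

-- Bounds on the protocol size of KW_f.

module _ {m n : ℕ} (f : BVec m → Bool) (i₀ : Fin m) (h : TruthTable n) {ℓ : ℕ} (L : IsL (KW f) ℓ) where

  private
    P₀ = proj₁ (proj₁ L)
    P₀-solves = proj₁ (proj₂ (proj₁ L))

    toTrue : ∀ {x y} → (∀ i → x i ≡ y i) → f x ≡ true → f y ≡ true
    toTrue = true-resp f P₀ P₀-solves

    toFalse : ∀ {x y} → (∀ i → x i ≡ y i) → f x ≡ false → f y ≡ false
    toFalse = false-resp f P₀ P₀-solves

  -- The inputs are compared at all coordinates.
  ℓ≤3*2^m : ℓ ≤ 3 * 2 ^ m
  ℓ≤3*2^m = ≤-trans (proj₂ L Q solves) (≤-trans (m≤m+n _ 2)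
    (≤-trans (≤-reflexive (leaves-diff i₀ nothing (λ i → i))) (*-monoʳ-≤ 3 (outside-≤ nothing))))
    where
    nothing = replicate m false
    lookup-nothing : ∀ {k} (i : Fin k) → lookup (replicate k false) i ≡ false
    lookup-nothing zero = refl
    lookup-nothing (suc i) = lookup-nothing i
    Q = diff i₀ nothing (λ i → i)
    solves : Solves Q (KW f)
    solves x y fx fy with diff-correct i₀ nothing (λ i → i) x y
    ... | inj₁ ok = ok
    ... | inj₂ same = ⊥-elim (true≢false (toTrue (λ i → same i (lookup-nothing i)) fx) fy)

  module _ (P : Protocol (BMat m (suc n)) (BMat m (suc n)) (Fin m × Fin (suc n)))
           (P-solves : Solves P (KW⊛ f (inner h))) where

    P-finds : ∀ a b u v → f (lookup a) ≡ true → f (lookup b) ≡ false →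
      let i , j = run P (entry (rows h a u)) (entry (rows h b v)) in
      lookup a i ≢ lookup b i × entry (rows h a u) i j ≢ entry (rows h b v) i j
    P-finds a b u v fa fb
      with P-solves (entry (rows h a u)) (entry (rows h b v))
             (toTrue (λ i → sym (inner-rows h a u i)) fa) (toFalse (λ i → sym (inner-rows h b v i)) fb)
    ... | g≢ , entry≢ = (λ e → g≢ (trans (inner-rows h a u _) (trans e (sym (inner-rows h b v _))))) , entry≢

    -- Blank tails in all rows embed the inputs of `f` into matrices, and the row index of the
    -- answer solves `KW f`.
    ℓ≤2^depth : ℓ ≤ 2 ^ depth P
    ℓ≤2^depth = ≤-trans (proj₂ L Q solves)
      (≤-trans (≤-reflexive (leaves-mapProtocol matrix matrix proj₁ P)) (leaves≤ P))
      where
      matrix : BVec m → BMat m (suc n)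
      matrix x = entry (rows h (tabulate x) (replicate m blank))
      Q : KWProtocol m
      Q = mapProtocol matrix matrix proj₁ P
      solves : Solves Q (KW f)
      solves x y fx fy = subst (λ i → x i ≢ y i) (sym (run-mapProtocol matrix matrix proj₁ P x y))
        λ e → proj₁ (P-finds (tabulate x) (tabulate y) _ _
                      (toTrue (λ i → sym (lookup∘tabulate x i)) fx)
                      (toFalse (λ i → sym (lookup∘tabulate y i)) fy))
                (trans (lookup∘tabulate x _) (trans e (sym (lookup∘tabulate y _))))

    module _ {e : ℕ} (avoiding : ∀ (c : Code m n e) → good h c ≡ false) where

      private
        everything : Rows m n → Bool
        everything _ = true

        xor-true : ∀ {b c} → b ≢ c → b xor c ≡ true
        xor-true {true} {true} p = ⊥-elim (p refl)
        xor-true {true} {false} p = refl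
        xor-true {false} {true} p = refl
        xor-true {false} {false} p = ⊥-elim (p refl)

        finds : ∀ a b u v → f (lookup a) ≡ true → f (lookup b) ≡ false →
          let i , j = run P (entry (rows h a u)) (entry (rows h b v)) in
          lookup (a ⊕ b) i ≡ true × entry (rows h a u) i j ≢ entry (rows h b v) i j
        finds a b u v fa fb = let a≢b , X≢Y = P-finds a b u v fa fb in
          trans (lookup-zipWith _xor_ _ a b) (xor-true a≢b) , X≢Y

        all-count : length (points n) ^ m ≤ 1 * count (points n) {m} everything
        all-count = ≤-reflexive (sym (trans (*-identityˡ _)
          (trans (∑-1 (vecs (points n) m)) (length-vecs (points n) m))))

      -- With all matrices allowed, a 1-input and a 0-input of `f` win on any set, so a protocol of
      -- depth at most `e` would yield a good code.
      e<depth : NonConstant f → e < depth P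
      e<depth ((x , fx) , (y , fy)) = ≰⇒> λ d →
        let c , g = winning-pair⇒good h i₀ e P (tabulate x) (tabulate y) everything everything d
              (λ u v _ _ → finds (tabulate x) (tabulate y) u v
                 (toTrue (λ i → sym (lookup∘tabulate x i)) fx)
                 (toFalse (λ i → sym (lookup∘tabulate y i)) fy))
              (win-all (points n) (points≢[] n) (tabulate x ⊕ tabulate y) everything (λ _ → refl))
              (win-all (points n) (points≢[] n) (tabulate x ⊕ tabulate y) everything (λ _ → refl))
        in true≢false g (avoiding c)

      ℓ-bound : ∀ t → depth P ≤ t + e →
        ℓ * (3 ^ m * 3 ^ m) ≤ 12 * (suc m * suc m) * 17 ^ m * (1 * 1 * 4 ^ t)
      ℓ-bound t d
        with descend h i₀ e t P (λ a → f (lookup a)) (λ b → not (f (lookup b)))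
               (λ _ → everything) (λ _ → everything) 1 1 d ≤-refl ≤-refl
               (λ _ _ → all-count) (λ _ _ → all-count)
               (λ a b u v fa fb _ _ → finds a b u v fa (not-true⁻ fb))
      ... | inj₁ (c , g) = ⊥-elim (true≢false g (avoiding c))
      ... | inj₂ (Q , sep , size≤) = ≤-trans (*-monoˡ-≤ (3 ^ m * 3 ^ m) (proj₂ L Q solves)) size≤
        where
        solves : Solves Q (KW f)
        solves x y fx fy = sep x y (toTrue (λ i → sym (lookup∘tabulate x i)) fx)
          (not-true⁺ (toFalse (λ i → sym (lookup∘tabulate y i)) fy))

-- With V = 2 ^ (m + d) * Z ^ c, the target is (ℓ * 2 ^ n) ^ q * 2 ^ (p * m) ≤ V ^ q.
expand : ∀ p q c m n d ℓ Z → (ℓ * 2 ^ n) ^ q * 2 ^ (p * m) ≤ (2 ^ (m + d) * Z ^ c) ^ q →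
  (ℓ ^ q) * (2 ^ (q * n)) * (2 ^ (p * m)) ≤ (2 ^ (q * d + q * m)) * (Z ^ (c * q))
expand p q c m n d ℓ Z = subst₂ _≤_
  (cong (_* 2 ^ (p * m)) (trans (^-distribʳ-* ℓ (2 ^ n) q)
    (cong (ℓ ^ q *_) (trans (^-*-assoc 2 n q) (cong (2 ^_) (*-comm n q))))))
  (trans (^-distribʳ-* (2 ^ (m + d)) (Z ^ c) q) (cong₂ _*_
    (trans (^-*-assoc 2 (m + d) q) (cong (2 ^_) (exponent m d q))) (^-*-assoc Z c q)))
  where
  exponent : ∀ m d q → (m + d) * q ≡ q * d + q * m
  exponent = solve-∀

-- The bounds ℓ ≤ 3 * 2 ^ m and ℓ-bound are multiplied: 4 ^ t then counts for the square of ℓ.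
square-bound : ∀ m n e t ℓ Z → 2 ≤ Z → suc m ≤ Z → ℓ ≤ 3 * 2 ^ m →
  ℓ * (3 ^ m * 3 ^ m) ≤ 12 * (suc m * suc m) * 17 ^ m * (1 * 1 * 4 ^ t) →
  2 ^ n ≤ 2048 * Z * 2 ^ e →
  (ℓ * 2 ^ n) ^ 2 * 18 ^ m ≤ (2 ^ (m + (t + e)) * Z ^ 17) ^ 2 * 17 ^ m
square-bound m n e t ℓ Z Z≥2 m<Z ℓ≤ ℓ≤' n≤ = begin
  (ℓ * 2 ^ n) ^ 2 * 18 ^ m
    ≡⟨ cong ((ℓ * 2 ^ n) ^ 2 *_) (trans (^-distribʳ-* 9 2 m) (cong (_* 2 ^ m) (^-distribʳ-* 3 3 m))) ⟩
  (ℓ * 2 ^ n) ^ 2 * (3 ^ m * 3 ^ m * 2 ^ m)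
    ≡⟨ e₁ ℓ (2 ^ n) (3 ^ m * 3 ^ m) (2 ^ m) ⟩
  ℓ * (ℓ * (3 ^ m * 3 ^ m)) * 2 ^ m * (2 ^ n * 2 ^ n)
    ≤⟨ *-mono-≤ (*-monoˡ-≤ (2 ^ m) (*-mono-≤ ℓ≤ ℓ≤')) (*-mono-≤ n≤ n≤) ⟩
  3 * 2 ^ m * (12 * (suc m * suc m) * 17 ^ m * (1 * 1 * 4 ^ t)) * 2 ^ m * (2048 * Z * 2 ^ e * (2048 * Z * 2 ^ e))
    ≡⟨ cong (λ z → 3 * 2 ^ m * (12 * (suc m * suc m) * 17 ^ m * (1 * 1 * z)) * 2 ^ m * (2048 * Z * 2 ^ e * (2048 * Z * 2 ^ e)))
         (^-distribʳ-* 2 2 t) ⟩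
  3 * 2 ^ m * (12 * (suc m * suc m) * 17 ^ m * (1 * 1 * (2 ^ t * 2 ^ t))) * 2 ^ m * (2048 * Z * 2 ^ e * (2048 * Z * 2 ^ e))
    ≡⟨ e₂ 3 12 2048 (2 ^ m) (suc m) (17 ^ m) (2 ^ t) Z (2 ^ e) ⟩
  3 * 12 * (2048 * 2048) * (suc m * suc m * (Z * Z)) * (2 ^ m * (2 ^ t * 2 ^ e) * (2 ^ m * (2 ^ t * 2 ^ e))) * 17 ^ m
    ≤⟨ *-monoˡ-≤ (17 ^ m) (*-monoˡ-≤ _ (*-mono-≤ constant (*-monoˡ-≤ (Z * Z) (*-mono-≤ m<Z m<Z)))) ⟩
  Z ^ 30 * (Z * Z * (Z * Z)) * (2 ^ m * (2 ^ t * 2 ^ e) * (2 ^ m * (2 ^ t * 2 ^ e))) * 17 ^ m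
    ≡⟨ cong₂ (λ x y → x * (y * y) * 17 ^ m) powers
         (sym (trans (^-distribˡ-+-* 2 m (t + e)) (cong (2 ^ m *_) (^-distribˡ-+-* 2 t e)))) ⟩
  Z ^ 17 * Z ^ 17 * (2 ^ (m + (t + e)) * 2 ^ (m + (t + e))) * 17 ^ m
    ≡⟨ e₃ (2 ^ (m + (t + e))) (Z ^ 17) (17 ^ m) ⟩
  (2 ^ (m + (t + e)) * Z ^ 17) ^ 2 * 17 ^ m ∎
  where
  open ≤-Reasoning
  e₁ : ∀ l x a b → (l * x) * ((l * x) * 1) * (a * b) ≡ l * (l * a) * b * (x * x)
  e₁ = solve-∀
  e₂ : ∀ i j k a s y b z c → i * a * (j * (s * s) * y * (1 * 1 * (b * b))) * a * (k * z * c * (k * z * c)) ≡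
    i * j * (k * k) * (s * s * (z * z)) * (a * (b * c) * (a * (b * c))) * y
  e₂ = solve-∀
  e₃ : ∀ a b c → b * b * (a * a) * c ≡ (a * b) * ((a * b) * 1) * c
  e₃ = solve-∀
  -- The numerical constants are below 2 ^ 30. With the four factors `suc m`, `suc m`, `Z`, `Z` this
  -- makes 34 powers of `Z`, and the square root leaves 17.
  constant : 3 * 12 * (2048 * 2048) ≤ Z ^ 30
  constant = ≤-trans (≤ᵇ⇒≤ (3 * 12 * (2048 * 2048)) (2 ^ 30) tt) (^-monoˡ-≤ 30 Z≥2)
  powers : Z ^ 30 * (Z * Z * (Z * Z)) ≡ Z ^ 17 * Z ^ 17
  powers = trans (cong (Z ^ 30 *_) (fourth Z)) (trans (sym (^-distribˡ-+-* Z 30 4)) (^-distribˡ-+-* Z 17 17))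
    where
    fourth : ∀ z → z * z * (z * z) ≡ z * (z * (z * (z * 1)))
    fourth = solve-∀

-- The hypothesis `base` says p / q ≤ log(18/17) / 2. Both sides are compared after squaring, since
-- the given bound concerns squares.
square-root : ∀ p q m u v → 17 ^ q * 2 ^ (2 * p) ≤ 18 ^ q → u ^ 2 * 18 ^ m ≤ v ^ 2 * 17 ^ m →
  u ^ q * 2 ^ (p * m) ≤ v ^ q
square-root p q m u v base le = ≮⇒≥ λ lt → <⇒≱ (^-monoˡ-< 2 lt)
  (*-cancelʳ-≤ _ _ ((17 ^ m) ^ q) {{m^n≢0 (17 ^ m) q {{m^n≢0 17 m}}}} (begin
    (u ^ q * 2 ^ (p * m)) ^ 2 * (17 ^ m) ^ q
      ≡⟨ cong (_* (17 ^ m) ^ q) (trans (^-distribʳ-* (u ^ q) (2 ^ (p * m)) 2)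
           (cong₂ _*_ (^-swap u q 2) (trans (^-*-assoc 2 (p * m) 2)
             (trans (cong (2 ^_) (exponent p m)) (sym (^-*-assoc 2 (2 * p) m)))))) ⟩
    (u ^ 2) ^ q * (2 ^ (2 * p)) ^ m * (17 ^ m) ^ q
      ≡⟨ trans (cong ((u ^ 2) ^ q * (2 ^ (2 * p)) ^ m *_) (^-swap 17 m q))
           (rearrange ((u ^ 2) ^ q) ((2 ^ (2 * p)) ^ m) ((17 ^ q) ^ m)) ⟩
    (u ^ 2) ^ q * ((17 ^ q) ^ m * (2 ^ (2 * p)) ^ m)
      ≡⟨ cong ((u ^ 2) ^ q *_) (sym (^-distribʳ-* (17 ^ q) (2 ^ (2 * p)) m)) ⟩
    (u ^ 2) ^ q * (17 ^ q * 2 ^ (2 * p)) ^ m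
      ≤⟨ *-monoʳ-≤ ((u ^ 2) ^ q) (^-monoˡ-≤ m base) ⟩
    (u ^ 2) ^ q * (18 ^ q) ^ m
      ≡⟨ trans (cong ((u ^ 2) ^ q *_) (^-swap 18 q m)) (sym (^-distribʳ-* (u ^ 2) (18 ^ m) q)) ⟩
    (u ^ 2 * 18 ^ m) ^ q
      ≤⟨ ^-monoˡ-≤ q le ⟩
    (v ^ 2 * 17 ^ m) ^ q
      ≡⟨ trans (^-distribʳ-* (v ^ 2) (17 ^ m) q) (cong (_* (17 ^ m) ^ q) (^-swap v 2 q)) ⟩
    (v ^ q) ^ 2 * (17 ^ m) ^ q ∎))
  where
  open ≤-Reasoning
  ^-swap : ∀ a i j → (a ^ i) ^ j ≡ (a ^ j) ^ i
  ^-swap a i j = trans (^-*-assoc a i j) (trans (cong (a ^_) (*-comm i j)) (sym (^-*-assoc a j i)))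
  exponent : ∀ p m → p * m * 2 ≡ 2 * p * m
  exponent = solve-∀
  rearrange : ∀ a b c → a * b * c ≡ a * (c * b)
  rearrange = solve-∀

largest-power : ∀ k a M → a ≤ M → M < a * 2 ^ k → ∃ λ e → a * 2 ^ e ≤ M × M < a * 2 ^ suc e
largest-power zero a M le lt = ⊥-elim (<⇒≱ lt (≤-trans (≤-reflexive (*-identityʳ a)) le))
largest-power (suc k) a M le lt with a * 2 ^ k ≤? M
... | yes p = k , p , lt
... | no ¬p = largest-power k a M le (≰⇒> ¬p)

someTable : ∀ n → TruthTable n
someTable zero = false
someTable (suc n) = someTable n , someTable n

-- Here n is itself O(log(m n)) and is absorbed by `Z ^ 17`; the gain 2 ^ (p m) is paid by 2 ^ (q
-- m).
small-case : ∀ p q m n d ℓ Z → p ≤ q → 2 ≤ Z → ℓ ≤ 2 ^ d → 2 ^ n < 512 * Z →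
  (ℓ * 2 ^ suc n) ^ q * 2 ^ (p * m) ≤ (2 ^ (m + d) * Z ^ 17) ^ q
small-case p q m n d ℓ Z p≤q Z≥2 ℓ≤ n< = begin
  (ℓ * 2 ^ suc n) ^ q * 2 ^ (p * m)
    ≤⟨ *-mono-≤ (^-monoˡ-≤ q (*-mono-≤ ℓ≤ power)) (^-monoʳ-≤ 2 (*-monoˡ-≤ m p≤q)) ⟩
  (2 ^ d * Z ^ 17) ^ q * 2 ^ (q * m)
    ≡⟨ trans (cong ((2 ^ d * Z ^ 17) ^ q *_) (trans (cong (2 ^_) (*-comm q m)) (sym (^-*-assoc 2 m q))))
         (sym (^-distribʳ-* (2 ^ d * Z ^ 17) (2 ^ m) q)) ⟩
  (2 ^ d * Z ^ 17 * 2 ^ m) ^ q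
    ≡⟨ cong (_^ q) (trans (rearrange (2 ^ d) (Z ^ 17) (2 ^ m)) (cong (_* Z ^ 17) (sym (^-distribˡ-+-* 2 m d)))) ⟩
  (2 ^ (m + d) * Z ^ 17) ^ q ∎
  where
  open ≤-Reasoning
  rearrange : ∀ a b c → a * b * c ≡ c * a * b
  rearrange = solve-∀
  power : 2 ^ suc n ≤ Z ^ 17
  power = begin
    2 * 2 ^ n       ≤⟨ *-monoʳ-≤ 2 (<⇒≤ n<) ⟩
    2 * (512 * Z)   ≡⟨ trans (sym (*-assoc 2 512 Z)) (*-comm 1024 Z) ⟩
    Z * 1024        ≤⟨ *-monoʳ-≤ Z (≤-trans (≤ᵇ⇒≤ 1024 (2 ^ 16) tt) (^-monoˡ-≤ 16 Z≥2)) ⟩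
    Z ^ 17          ∎

-- The first d - e rounds are simulated and the last `e` are forced by the choice of `h`. As
-- `inner h` has `suc n` variables, 2 * 512 * 2 gives the constant 2048.
large-case : ∀ p q m n e d ℓ Z → 17 ^ q * 2 ^ (2 * p) ≤ 18 ^ q → 2 ≤ Z → suc m ≤ Z →
  2 ^ n < 512 * Z * 2 ^ suc e → e < d → ℓ ≤ 3 * 2 ^ m →
  ℓ * (3 ^ m * 3 ^ m) ≤ 12 * (suc m * suc m) * 17 ^ m * (1 * 1 * 4 ^ (d ∸ e)) →
  (ℓ * 2 ^ suc n) ^ q * 2 ^ (p * m) ≤ (2 ^ (m + d) * Z ^ 17) ^ q
large-case p q m n e d ℓ Z base Z≥2 m<Z n< e<d ℓ≤ ℓ≤' =
  subst (λ x → (ℓ * 2 ^ suc n) ^ q * 2 ^ (p * m) ≤ (2 ^ (m + x) * Z ^ 17) ^ q) (m∸n+n≡m (<⇒≤ e<d))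
    (square-root p q m _ _ base
      (square-bound m (suc n) e (d ∸ e) ℓ Z Z≥2 m<Z ℓ≤ ℓ≤'
        (≤-trans (*-monoʳ-≤ 2 (<⇒≤ n<)) (≤-reflexive (collect 512 Z (2 ^ e))))))
  where
  collect : ∀ k z x → 2 * (k * z * (2 * x)) ≡ 2 * (2 * k) * z * x
  collect = solve-∀

module _ (p q : ℕ) (p≤q : p ≤ q) (base : 17 ^ q * 2 ^ (2 * p) ≤ 18 ^ q) where

  private
    Bound : (m : ℕ) (f : BVec m → Bool) (n : ℕ) (g : BVec n → Bool) → Set
    Bound m f n g = ∀ (d ℓ : ℕ) → IsCC (KW⊛ f g) d → IsL (KW f) ℓ →
      (ℓ ^ q) * (2 ^ (q * n)) * (2 ^ (p * m)) ≤ (2 ^ (q * d + q * m)) * ((2 * m * n) ^ (17 * q))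

    module _ (k n : ℕ) where
      m = suc k
      Z = 2 * m * suc n

      Z≥2 : 2 ≤ Z
      Z≥2 = *-mono-≤ {2} {2 * m} (*-monoʳ-≤ 2 {1} {m} (s≤s z≤n)) (s≤s z≤n)

      m<Z : suc m ≤ Z
      m<Z = ≤-trans (+-mono-≤ {1} {m} {m} {m + 0} (s≤s z≤n) (m≤m+n m 0)) (m≤m*n (2 * m) (suc n))

      2^n<512Z2^n : 2 ^ n < 512 * Z * 2 ^ n
      2^n<512Z2^n = <-≤-trans (m<m+n (2 ^ n) (≤-trans (m^n>0 2 n) (m≤m+n (2 ^ n) 0)))
        (*-monoˡ-≤ (2 ^ n) (≤-trans Z≥2 (m≤n*m Z 512)))

      small : ∀ f → 2 ^ n < 512 * Z → Bound m f (suc n) (inner (someTable n))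
      small f lt d ℓ ((P , P-solves , depth≡d) , _) L =
        expand p q 17 m (suc n) d ℓ Z (small-case p q m n d ℓ Z p≤q Z≥2
          (subst (λ d → ℓ ≤ 2 ^ d) depth≡d (ℓ≤2^depth f zero (someTable n) L P P-solves)) lt)

      large : ∀ f → NonConstant f → ∀ e → 2 ^ n < 512 * Z * 2 ^ suc e →
        (h : TruthTable n) → (∀ (c : Code m n e) → good h c ≡ false) → Bound m f (suc n) (inner h)
      large f f-nonconstant e lt h avoiding d ℓ ((P , P-solves , depth≡d) , _) L =
        expand p q 17 m (suc n) d ℓ Z
          (large-case p q m n e d ℓ Z base Z≥2 m<Z lt e<d (ℓ≤3*2^m f zero h L)
            (ℓ-bound f zero h L P P-solves avoiding (d ∸ e)
              (≤-reflexive (trans depth≡d (sym (m∸n+n≡m (<⇒≤ e<d)))))))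
        where
        e<d : e < d
        e<d = subst (e <_) depth≡d (e<depth f zero h L P P-solves avoiding f-nonconstant)

  composition-bound : ∀ (m : ℕ) (f : BVec m → Bool) → NonConstant f → ∀ (n : ℕ) → 1 ≤ n →
    ∃ λ (g : BVec n → Bool) → Bound m f n g
  -- For m = 0 a protocol would have to output an element of `Fin 0`.
  composition-bound zero f ((x , _) , (y , _)) n _ =
    (λ _ → false) , λ d ℓ _ L → ⊥-elim (no-index (run (proj₁ (proj₁ L)) x y))
    where
    no-index : Fin 0 → ⊥
    no-index ()
  composition-bound (suc k) f f-nonconstant (suc n) _ = by-size (≤-<-connex (512 * Z k n) (2 ^ n))
    where
    by-size : 512 * Z k n ≤ 2 ^ n ⊎ 2 ^ n < 512 * Z k n →
      ∃ λ (g : BVec (suc n) → Bool) → Bound (suc k) f (suc n) g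
    by-size (inj₂ lt) = inner (someTable n) , small k n f lt
    by-size (inj₁ le) =
      -- `e` is maximal for the union bound, so 2 ^ n is less than 1024 * Z * 2 ^ e.
      let e , e≤ , e> = largest-power n (512 * Z k n) (2 ^ n) le (2^n<512Z2^n k n)
          h , avoiding = exists-avoiding {suc k} {n} {e} (s≤s z≤n) e≤
      in inner h , large k n f f-nonconstant e e> h avoiding

-- With γ = p / q, the inequality is multiplied by `q` and placed in the exponent of 2; the error
-- term is c log(2 m n), and q < 25 p says γ > 0.04.
theorem3p1 : Σ ℕ λ p → Σ ℕ λ q → Σ ℕ λ c → (0 < q) × (q < 25 * p) ×
    (∀ (m : ℕ) (f : BVec m → Bool) → NonConstant f →
    ∀ (n : ℕ) → 1 ≤ n →
    ∃ λ (g : BVec n → Bool) →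
    ∀ (d ℓ : ℕ) → IsCC (KW⊛ f g) d → IsL (KW f) ℓ →
    (ℓ ^ q) * (2 ^ (q * n)) * (2 ^ (p * m))
    ≤ (2 ^ (q * d + q * m)) * ((2 * m * n) ^ (c * q)))
-- 7/170 lies between 1/25 and log(18/17) / 2; the upper bound is checked as 17 ^ 170 * 2 ^ 14 ≤ 18
-- ^ 170.
theorem3p1 = 7 , 170 , 17 , s≤s z≤n , ≤ᵇ⇒≤ 171 175 tt ,
  composition-bound 7 170 (≤ᵇ⇒≤ 7 170 tt) (≤ᵇ⇒≤ (17 ^ 170 * 2 ^ 14) (18 ^ 170) tt)
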